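{- There are exactly $2^4\cdot 5!=1920$ magic-faced tesseracts, and hence exactly $1920$ arrangements of the numbers $1,\dots,16$ in a $4\times4$ square such that every row, every column, and every $2\times2$ subsquare (including those that wrap around) sums to the magic constant $34$. These are all equivalent to each other under a natural, faithful action of the group $\mathrm{Aut}(FQ_4)\cong C_2^4\rtimes S_5$, of order $1920$.
   Context: $Q_4$ is the hypercube graph on $\{0,1\}^4$ (adjacent iff differing in exactly one coordinate). A magic-faced tesseract is a bijective labeling of the vertices of $Q_4$ by $1,\ldots,16$ such that every $4$-cycle of $Q_4$ (equivalently, every $2\times 2$ face) has the same sum of labels. $FQ_4$ is the folded hypercube graph: $Q_4$ together with an edge joining each pair of antipodal vertices (vertices differing in all $4$ coordinates). In $C_2^4\rtimes S_5$, $C_2^4$ is identified with $\mathbb F_2^5/\langle e_0+\cdots+e_4\rangle$ and $S_5$ permutes the standard basis vectors $e_0,\ldots,e_4$. Positions of a $4\times 4$ square are viewed as vertices of the toroidal grid graph $C_4\times C_4$ (Cartesian product of two $4$-cycles), which is isomorphic as a graph to $Q_4$; a $2\times2$ subsquare consists of the positions $\{i,i+1\}\times\{j,j+1\}$ with indices modulo $4$. The natural action is: $\mathrm{Aut}(FQ_4)$ permutes the vertices of $FQ_4$, i.e. the vertices of $Q_4$, hence acts on labelings of $Q_4$, and (via a fixed graph isomorphism $C_4\times C_4\cong Q_4$) on arrangements in the $4\times 4$ square. -}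

module Defs where

open import Algebra.Bundles using (Group; AbelianGroup; CommutativeRing)
import Algebra.Construct.Pointwise as Pointwise
open import Algebra.Morphism.Structures using (module GroupMorphisms)
import Algebra.Properties.AbelianGroup as AbelianGroupProperties
open import Data.Bool.Base using (Bool; true; false; _∧_; _xor_)
open import Data.Bool.Properties
  using (xor-comm; xor-same; ∧-distribʳ-xor; xor-∧-commutativeRing)
open import Data.Fin.Base using (Fin; toℕ)
open import Data.Fin.Patterns
open import Data.Fin.Properties using (_≟_)
open import Data.Fin.Subset using (∣_∣)
open import Data.Nat.Base using (ℕ; suc; _+_; NonZero)
open import Data.Nat.DivMod using (_mod_)
open import Data.Product.Base using (Σ; ∃; _×_; _,_; proj₁; proj₂)
open import Data.Sum.Base using (_⊎_; inj₁; inj₂; swap)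
import Data.Sum.Base as Sum
open import Data.Vec.Base using (Vec; []; _∷_; zipWith; tabulate; sum)
open import Data.Vec.Properties using (zipWith-comm)
open import Function.Base using (_∘_)
open import Function.Bundles using (Inverse; _↔_)
open import Function.Construct.Composition using (_↔-∘_)
open import Function.Construct.Identity using (↔-id)
open import Function.Construct.Symmetry using (↔-sym)
open import Function.Definitions using (Injective)
open import Level using (Level; 0ℓ; _⊔_)
open import Relation.Binary.Bundles using (Setoid)
open import Relation.Binary.Core using (Rel)
open import Relation.Binary.Definitions using (Irreflexive; Symmetric)
import Relation.Binary.Construct.On as On
open import Relation.Binary.PropositionalEquality
  using (_≡_; refl; sym; trans; cong; cong₂)
import Relation.Binary.PropositionalEquality as ≡
import Relation.Binary.Reasoning.Setoid as SetoidReasoning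
open import Relation.Nullary.Decidable.Core using (does)
open import Relation.Unary using (Pred; _∈_)

private
  variable
    a b c ℓ ℓ₁ ℓ₂ p : Level

HasCardinality : Setoid c ℓ → ℕ → Set (c ⊔ ℓ)
HasCardinality S n = Inverse S (≡.setoid (Fin n))

_≅ᴳ_ : Group a ℓ₁ → Group b ℓ₂ → Set (a ⊔ b ⊔ ℓ₁ ⊔ ℓ₂)
G ≅ᴳ H = Σ (Group.Carrier G → Group.Carrier H) IsGroupIsomorphism
  where open GroupMorphisms (Group.rawGroup G) (Group.rawGroup H)

module _ (G : Group a ℓ₁) (S : Setoid b ℓ₂) where
  private
    module G = Group G
    module S = Setoid S

  record LeftAction : Set (a ⊔ b ⊔ ℓ₁ ⊔ ℓ₂) where
    infixr 7 _·_
    field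
      _·_        : G.Carrier → S.Carrier → S.Carrier
      ·-cong     : ∀ {g h x y} → g G.≈ h → x S.≈ y → (g · x) S.≈ (h · y)
      ·-identity : ∀ x → (G.ε · x) S.≈ x
      ·-assoc    : ∀ g h x → ((g G.∙ h) · x) S.≈ (g · (h · x))

module _ {G : Group a ℓ₁} {S : Setoid b ℓ₂} (act : LeftAction G S) where
  private
    module G = Group G
    module S = Setoid S
  open LeftAction act

  Faithful : Set (a ⊔ b ⊔ ℓ₁ ⊔ ℓ₂)
  Faithful = ∀ g → (∀ x → (g · x) S.≈ x) → g G.≈ G.ε

  Transitive : Set (a ⊔ b ⊔ ℓ₂)
  Transitive = ∀ x y → ∃ λ g → (g · x) S.≈ y

  Stable : Pred S.Carrier p → Set (a ⊔ b ⊔ p)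
  Stable P = ∀ g {x} → x ∈ P → (g · x) ∈ P

subsetoid : (S : Setoid b ℓ₂) → Pred (Setoid.Carrier S) p → Setoid (b ⊔ p) ℓ₂
subsetoid S P = On.setoid {B = Σ (Setoid.Carrier S) P} S proj₁

restrict : {G : Group a ℓ₁} {S : Setoid b ℓ₂} (act : LeftAction G S)
           (P : Pred (Setoid.Carrier S) p) → Stable act P →
           LeftAction G (subsetoid S P)
restrict act P stable = record
  { _·_        = λ { g (x , x∈P) → g · x , stable g x∈P }
  ; ·-cong     = ·-cong
  ; ·-identity = λ x → ·-identity (proj₁ x)
  ; ·-assoc    = λ g h x → ·-assoc g h (proj₁ x)
  }
  where open LeftAction act

ActsFaithfullyTransitivelyOn :
  {G : Group a ℓ₁} {S : Setoid b ℓ₂} → LeftAction G S →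
  Pred (Setoid.Carrier S) p → Set (a ⊔ b ⊔ ℓ₁ ⊔ ℓ₂ ⊔ p)
ActsFaithfullyTransitivelyOn act P =
  Σ (Stable act P) λ stable →
    Faithful (restrict act P stable) × Transitive (restrict act P stable)

bijectionSetoid : Set a → Set b → Setoid (a ⊔ b) (a ⊔ b)
bijectionSetoid {a} {b} A B = record
  { Carrier       = A ↔ B
  ; _≈_           = λ f g → ∀ x → Inverse.to f x ≡ Inverse.to g x
  ; isEquivalence = record
    { refl  = λ _ → refl
    ; sym   = λ p x → sym (p x)
    ; trans = λ p q x → trans (p x) (q x)
    }
  }

from-cong : {A : Set a} {B : Set b} (f g : A ↔ B) →
            (∀ x → Inverse.to f x ≡ Inverse.to g x) →
            ∀ y → Inverse.from f y ≡ Inverse.from g y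
from-cong f g p y =
  trans (sym (Inverse.strictlyInverseʳ g (f⁻¹ y)))
    (cong (Inverse.from g)
      (trans (sym (p (f⁻¹ y))) (Inverse.strictlyInverseˡ f y)))
  where f⁻¹ = Inverse.from f

SymmetricGroup : Set a → Group a a
SymmetricGroup A = record
  { Carrier = A ↔ A
  ; _≈_     = Setoid._≈_ (bijectionSetoid A A)
  ; _∙_     = λ f g → f ↔-∘ g
  ; ε       = ↔-id A
  ; _⁻¹     = ↔-sym
  ; isGroup = record
    { isMonoid = record
      { isSemigroup = record
        { isMagma = record
          { isEquivalence = Setoid.isEquivalence (bijectionSetoid A A)
          ; ∙-cong = λ {f} {g} {h} {k} p q x →
              trans (p (Inverse.to h x)) (cong (Inverse.to g) (q x))
          }
        ; assoc = λ _ _ _ _ → refl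
        }
      ; identity = (λ _ _ → refl) , (λ _ _ → refl)
      }
    ; inverse = Inverse.strictlyInverseʳ , Inverse.strictlyInverseˡ
    ; ⁻¹-cong = λ {f} {g} → from-cong f g
    }
  }

module _ (A : AbelianGroup c ℓ) where
  open AbelianGroup A

  record IsSubgroup (P : Pred Carrier p) : Set (c ⊔ ℓ ⊔ p) where
    field
      resp  : ∀ {x y} → x ≈ y → x ∈ P → y ∈ P
      ε∈    : ε ∈ P
      ∙∈    : ∀ {x y} → x ∈ P → y ∈ P → (x ∙ y) ∈ P
      ⁻¹∈   : ∀ {x} → x ∈ P → (x ⁻¹) ∈ P

  module _ {P : Pred Carrier p} (isSubgroup : IsSubgroup P) where
    open IsSubgroup isSubgroup
    open AbelianGroupProperties A
      using (⁻¹-involutive; ⁻¹-anti-homo-∙; ⁻¹-∙-comm)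
    open import Algebra.Properties.CommutativeSemigroup commutativeSemigroup
      using (interchange)
    open SetoidReasoning setoid
    private
      module A = AbelianGroup A

      infix 4 _~_
      _~_ : Rel Carrier p
      x ~ y = (x ∙ y ⁻¹) ∈ P

      ≈⇒~ : ∀ {x y} → x ≈ y → x ~ y
      ≈⇒~ {x} {y} x≈y = resp
        (A.sym (A.trans (A.∙-congʳ x≈y) (A.inverseʳ y))) ε∈

      ~-sym : ∀ {x y} → x ~ y → y ~ x
      ~-sym {x} {y} x~y = resp
        (begin
          (x ∙ y ⁻¹) ⁻¹    ≈⟨ ⁻¹-anti-homo-∙ x (y ⁻¹) ⟩
          y ⁻¹ ⁻¹ ∙ x ⁻¹   ≈⟨ A.∙-congʳ (⁻¹-involutive y) ⟩
          y ∙ x ⁻¹         ∎)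
        (⁻¹∈ x~y)

      ~-trans : ∀ {x y z} → x ~ y → y ~ z → x ~ z
      ~-trans {x} {y} {z} x~y y~z = resp
        (begin
          (x ∙ y ⁻¹) ∙ (y ∙ z ⁻¹)  ≈⟨ A.assoc x (y ⁻¹) (y ∙ z ⁻¹) ⟩
          x ∙ (y ⁻¹ ∙ (y ∙ z ⁻¹))  ≈⟨ A.∙-congˡ (A.assoc (y ⁻¹) y (z ⁻¹)) ⟨
          x ∙ ((y ⁻¹ ∙ y) ∙ z ⁻¹)  ≈⟨ A.∙-congˡ (A.∙-congʳ (A.inverseˡ y)) ⟩
          x ∙ (ε ∙ z ⁻¹)           ≈⟨ A.∙-congˡ (A.identityˡ (z ⁻¹)) ⟩
          x ∙ z ⁻¹                 ∎)
        (∙∈ x~y y~z)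

      ~-∙-cong : ∀ {x y u v} → x ~ y → u ~ v → x ∙ u ~ y ∙ v
      ~-∙-cong {x} {y} {u} {v} x~y u~v = resp
        (begin
          (x ∙ y ⁻¹) ∙ (u ∙ v ⁻¹)  ≈⟨ interchange x (y ⁻¹) u (v ⁻¹) ⟩
          (x ∙ u) ∙ (y ⁻¹ ∙ v ⁻¹)  ≈⟨ A.∙-congˡ (⁻¹-∙-comm y v) ⟩
          (x ∙ u) ∙ (y ∙ v) ⁻¹     ∎)
        (∙∈ x~y u~v)

      ~-⁻¹-cong : ∀ {x y} → x ~ y → x ⁻¹ ~ y ⁻¹
      ~-⁻¹-cong {x} {y} x~y = resp (A.sym (⁻¹-∙-comm x (y ⁻¹))) (⁻¹∈ x~y)

    quotientGroup : Group c p
    quotientGroup = record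
      { Carrier = Carrier
      ; _≈_     = _~_
      ; _∙_     = _∙_
      ; ε       = ε
      ; _⁻¹     = _⁻¹
      ; isGroup = record
        { isMonoid = record
          { isSemigroup = record
            { isMagma = record
              { isEquivalence = record
                { refl  = ≈⇒~ A.refl
                ; sym   = ~-sym
                ; trans = ~-trans
                }
              ; ∙-cong = ~-∙-cong
              }
            ; assoc = λ x y z → ≈⇒~ (A.assoc x y z)
            }
          ; identity = (λ x → ≈⇒~ (A.identityˡ x)) , (λ x → ≈⇒~ (A.identityʳ x))
          }
        ; inverse = (λ x → ≈⇒~ (A.inverseˡ x)) , (λ x → ≈⇒~ (A.inverseʳ x))
        ; ⁻¹-cong = ~-⁻¹-cong
        }
      }

module _ (N : Group a ℓ₁) (H : Group b ℓ₂)
         (act : LeftAction H (Group.setoid N)) where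
  private
    module N = Group N
    module H = Group H
  open LeftAction act

  ByEndomorphisms : Set (a ⊔ b ⊔ ℓ₁)
  ByEndomorphisms = ∀ h x y → (h · (x N.∙ y)) N.≈ ((h · x) N.∙ (h · y))

  module _ (·-distrib : ByEndomorphisms) where
    open import Algebra.Properties.Group N using (identityˡ-unique)
    open SetoidReasoning N.setoid
    private
      ·-ε : ∀ h → (h · N.ε) N.≈ N.ε
      ·-ε h = identityˡ-unique (h · N.ε) (h · N.ε)
        (N.trans (N.sym (·-distrib h N.ε N.ε))
                 (·-cong H.refl (N.identityˡ N.ε)))

    semidirectProduct : Group (a ⊔ b) (ℓ₁ ⊔ ℓ₂)
    semidirectProduct = record
      { Carrier = N.Carrier × H.Carrier
      ; _≈_     = λ (n , h) (n′ , h′) → n N.≈ n′ × h H.≈ h′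
      ; _∙_     = λ (n , h) (n′ , h′) → n N.∙ (h · n′) , h H.∙ h′
      ; ε       = N.ε , H.ε
      ; _⁻¹     = λ (n , h) → (h H.⁻¹) · (n N.⁻¹) , h H.⁻¹
      ; isGroup = record
        { isMonoid = record
          { isSemigroup = record
            { isMagma = record
              { isEquivalence = record
                { refl  = N.refl , H.refl
                ; sym   = λ (p , q) → N.sym p , H.sym q
                ; trans = λ (p , q) (p′ , q′) → N.trans p p′ , H.trans q q′
                }
              ; ∙-cong = λ (p , q) (p′ , q′) →
                  N.∙-cong p (·-cong q p′) , H.∙-cong q q′
              }
            ; assoc = λ (n , h) (n′ , h′) (n″ , h″) →
                (begin
                  (n N.∙ (h · n′)) N.∙ ((h H.∙ h′) · n″)
                    ≈⟨ N.assoc _ _ _ ⟩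
                  n N.∙ ((h · n′) N.∙ ((h H.∙ h′) · n″))
                    ≈⟨ N.∙-congˡ (N.∙-congˡ (·-assoc h h′ n″)) ⟩
                  n N.∙ ((h · n′) N.∙ (h · (h′ · n″)))
                    ≈⟨ N.∙-congˡ (·-distrib h n′ (h′ · n″)) ⟨
                  n N.∙ (h · (n′ N.∙ (h′ · n″)))
                    ∎) ,
                H.assoc h h′ h″
            }
          ; identity =
              (λ (n , h) →
                N.trans (N.identityˡ _) (·-identity n) , H.identityˡ h) ,
              (λ (n , h) →
                N.trans (N.∙-congˡ (·-ε h)) (N.identityʳ n) , H.identityʳ h)
          }
        ; inverse =
            (λ (n , h) →
              (begin
                ((h H.⁻¹) · (n N.⁻¹)) N.∙ ((h H.⁻¹) · n)
                  ≈⟨ ·-distrib (h H.⁻¹) (n N.⁻¹) n ⟨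
                (h H.⁻¹) · ((n N.⁻¹) N.∙ n)
                  ≈⟨ ·-cong H.refl (N.inverseˡ n) ⟩
                (h H.⁻¹) · N.ε
                  ≈⟨ ·-ε (h H.⁻¹) ⟩
                N.ε ∎) ,
              H.inverseˡ h) ,
            (λ (n , h) →
              (begin
                n N.∙ (h · ((h H.⁻¹) · (n N.⁻¹)))
                  ≈⟨ N.∙-congˡ (·-assoc h (h H.⁻¹) (n N.⁻¹)) ⟨
                n N.∙ ((h H.∙ (h H.⁻¹)) · (n N.⁻¹))
                  ≈⟨ N.∙-congˡ (·-cong (H.inverseʳ h) N.refl) ⟩
                n N.∙ (H.ε · (n N.⁻¹))
                  ≈⟨ N.∙-congˡ (·-identity (n N.⁻¹)) ⟩
                n N.∙ (n N.⁻¹)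
                  ≈⟨ N.inverseʳ n ⟩
                N.ε ∎) ,
              H.inverseʳ h)
        ; ⁻¹-cong = λ (p , q) → ·-cong (H.⁻¹-cong q) (N.⁻¹-cong p) , H.⁻¹-cong q
        }
      }

𝔽₂⁵ : AbelianGroup 0ℓ 0ℓ
𝔽₂⁵ = Pointwise.abelianGroup (Fin 5)
        (CommutativeRing.+-abelianGroup xor-∧-commutativeRing)

private
  module 𝔽₂⁵ = AbelianGroup 𝔽₂⁵

e : Fin 5 → 𝔽₂⁵.Carrier
e k i = does (k ≟ i)

e₀+⋯+e₄ : 𝔽₂⁵.Carrier
e₀+⋯+e₄ = e 0F 𝔽₂⁵.∙ e 1F 𝔽₂⁵.∙ e 2F 𝔽₂⁵.∙ e 3F 𝔽₂⁵.∙ e 4F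

-- The 𝔽₂-span of s; scalar multiplication is _∧_.
⟨_⟩ : 𝔽₂⁵.Carrier → Pred 𝔽₂⁵.Carrier 0ℓ
⟨ s ⟩ v = ∃ λ (k : Bool) → v 𝔽₂⁵.≈ (λ i → k ∧ s i)

⟨⟩-isSubgroup : ∀ s → IsSubgroup 𝔽₂⁵ ⟨ s ⟩
⟨⟩-isSubgroup s = record
  { resp = λ v≈w (k , v≈ks) → k , λ i → trans (sym (v≈w i)) (v≈ks i)
  ; ε∈   = false , λ _ → refl
  ; ∙∈   = λ (k , p) (l , q) → k xor l , λ i →
      trans (cong₂ _xor_ (p i) (q i)) (sym (∧-distribʳ-xor (s i) k l))
  ; ⁻¹∈  = λ v∈ → v∈
  }

-- C₂⁴ is realised as 𝔽₂⁵ / ⟨ e₀ + ⋯ + e₄ ⟩.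
C₂⁴ : Group 0ℓ 0ℓ
C₂⁴ = quotientGroup 𝔽₂⁵ (⟨⟩-isSubgroup e₀+⋯+e₄)

S₅ : Group 0ℓ 0ℓ
S₅ = SymmetricGroup (Fin 5)

private
  e₀+⋯+e₄≗1 : ∀ i → e₀+⋯+e₄ i ≡ true
  e₀+⋯+e₄≗1 0F = refl
  e₀+⋯+e₄≗1 1F = refl
  e₀+⋯+e₄≗1 2F = refl
  e₀+⋯+e₄≗1 3F = refl
  e₀+⋯+e₄≗1 4F = refl

  ≗⇒≈ : ∀ {v w : 𝔽₂⁵.Carrier} → (∀ i → v i ≡ w i) → Group._≈_ C₂⁴ v w
  ≗⇒≈ {v} {w} p = false , λ i →
    trans (cong (_xor w i) (p i)) (xor-same (w i))

-- The inverse makes σ send e k to e (σ k).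
permuteBasis : LeftAction S₅ (Group.setoid C₂⁴)
permuteBasis = record
  { _·_        = λ σ v → v ∘ Inverse.from σ
  ; ·-cong     = λ {σ} {τ} {v} {w} σ≈τ (k , p) → k , λ i →
      trans (cong (λ j → v (Inverse.from σ i) xor w j) (sym (from-cong σ τ σ≈τ i)))
        (trans (p (Inverse.from σ i))
          (cong (k ∧_) (trans (e₀+⋯+e₄≗1 (Inverse.from σ i)) (sym (e₀+⋯+e₄≗1 i)))))
  ; ·-identity = λ v → ≗⇒≈ {v} {v} λ _ → refl
  ; ·-assoc    = λ σ τ v → ≗⇒≈ {v ∘ Inverse.from τ ∘ Inverse.from σ} λ _ → refl
  }

C₂⁴⋊S₅ : Group 0ℓ 0ℓ
C₂⁴⋊S₅ = semidirectProduct C₂⁴ S₅ permuteBasis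
  λ σ v w → Group.refl C₂⁴ {(v 𝔽₂⁵.∙ w) ∘ Inverse.from σ}

record Graph : Set₁ where
  field
    Vertex   : Set
    Adj      : Rel Vertex 0ℓ
    symm     : Symmetric Adj
    loopless : Irreflexive _≡_ Adj

open Graph

record GraphIso (G H : Graph) : Set where
  field
    bijection : Vertex G ↔ Vertex H
  open Inverse bijection public using (to; from)
  field
    preserves : ∀ {u v} → Adj G u v → Adj H (to u) (to v)
    reflects  : ∀ {u v} → Adj H (to u) (to v) → Adj G u v

open GraphIso using (bijection)

Aut : Graph → Group 0ℓ 0ℓ
Aut G = record
  { Carrier = GraphIso G G
  ; _≈_     = λ f g → bijection f Sym.≈ bijection g
  ; _∙_     = λ f g → record
    { bijection = bijection f Sym.∙ bijection g
    ; preserves = GraphIso.preserves f ∘ GraphIso.preserves g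
    ; reflects  = GraphIso.reflects g ∘ GraphIso.reflects f
    }
  ; ε       = record
    { bijection = Sym.ε
    ; preserves = λ uv → uv
    ; reflects  = λ uv → uv
    }
  ; _⁻¹     = λ f → let module f = Inverse (bijection f) in record
    { bijection = bijection f Sym.⁻¹
    ; preserves = λ {u} {v} uv → GraphIso.reflects f
        (≡.subst₂ (Adj G) (sym (f.strictlyInverseˡ u)) (sym (f.strictlyInverseˡ v)) uv)
    ; reflects  = λ {u} {v} uv →
        ≡.subst₂ (Adj G) (f.strictlyInverseˡ u) (f.strictlyInverseˡ v)
          (GraphIso.preserves f uv)
    }
  ; isGroup = record
    { isMonoid = record
      { isSemigroup = record
        { isMagma = record
          { isEquivalence = On.isEquivalence bijection Sym.isEquivalence
          ; ∙-cong = λ {f} {g} {h} {k} →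
              Sym.∙-cong {bijection f} {bijection g} {bijection h} {bijection k}
          }
        ; assoc = λ _ _ _ _ → refl
        }
      ; identity = (λ _ _ → refl) , (λ _ _ → refl)
      }
    ; inverse = (λ f → Sym.inverseˡ (bijection f)) , (λ f → Sym.inverseʳ (bijection f))
    ; ⁻¹-cong = λ {f} {g} → Sym.⁻¹-cong {bijection f} {bijection g}
    }
  }
  where module Sym = Group (SymmetricGroup (Vertex G))

hammingDistance : ∀ {n} → Vec Bool n → Vec Bool n → ℕ
hammingDistance u v = ∣ zipWith _xor_ u v ∣

private
  hammingDistance-comm : ∀ {n} (u v : Vec Bool n) →
                         hammingDistance u v ≡ hammingDistance v u
  hammingDistance-comm u v = cong ∣_∣ (zipWith-comm xor-comm u v)

  hammingDistance-self : ∀ {n} (u : Vec Bool n) → hammingDistance u u ≡ 0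
  hammingDistance-self []          = refl
  hammingDistance-self (true ∷ u)  = hammingDistance-self u
  hammingDistance-self (false ∷ u) = hammingDistance-self u

hypercube : ℕ → Graph
hypercube n = record
  { Vertex   = Vec Bool n
  ; Adj      = λ u v → hammingDistance u v ≡ 1
  ; symm     = λ {u} {v} → trans (hammingDistance-comm v u)
  ; loopless = λ { {u} refl d≡1 → 0≢1 (trans (sym (hammingDistance-self u)) d≡1) }
  }
  where
  0≢1 : ∀ {A : Set} → 0 ≡ 1 → A
  0≢1 ()

foldedHypercube : (n : ℕ) .{{_ : NonZero n}} → Graph
foldedHypercube (suc n) = record
  { Vertex   = Vec Bool (suc n)
  ; Adj      = λ u v → Adj (hypercube (suc n)) u v ⊎ hammingDistance u v ≡ suc n
  ; symm     = λ {u} {v} →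
      Sum.map (symm (hypercube (suc n)) {u} {v}) (trans (hammingDistance-comm v u))
  ; loopless = λ
    { {u} refl (inj₁ uu) → loopless (hypercube (suc n)) {u} refl uu
    ; {u} refl (inj₂ d)  → 0≢suc (trans (sym (hammingDistance-self u)) d)
    }
  }
  where
  0≢suc : ∀ {A : Set} → 0 ≡ suc n → A
  0≢suc ()

Q₄ FQ₄ : Graph
Q₄  = hypercube 4
FQ₄ = foldedHypercube 4

next : Fin 4 → Fin 4
next i = suc (toℕ i) mod 4

C₄ : Graph
C₄ = record
  { Vertex   = Fin 4
  ; Adj      = λ i j → j ≡ next i ⊎ i ≡ next j
  ; symm     = swap
  ; loopless = λ { {i} refl (inj₁ p) → i≢next i p ; {i} refl (inj₂ p) → i≢next i p }
  }
  where
  i≢next : ∀ {A : Set} i → i ≡ next i → A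
  i≢next 0F ()
  i≢next 1F ()
  i≢next 2F ()
  i≢next 3F ()

infixr 6 _□_

_□_ : Graph → Graph → Graph
G □ H = record
  { Vertex   = Vertex G × Vertex H
  ; Adj      = λ (u , v) (u′ , v′) → (u ≡ u′ × Adj H v v′) ⊎ (Adj G u u′ × v ≡ v′)
  ; symm     = Sum.map (λ (p , q) → sym p , symm H q) (λ (p , q) → symm G p , sym q)
  ; loopless = λ { refl (inj₁ (_ , q)) → loopless H refl q
                 ; refl (inj₂ (p , _)) → loopless G refl p }
  }

record FourCycle (G : Graph) : Set where
  field
    vertex   : Fin 4 → Vertex G
    distinct : Injective _≡_ _≡_ vertex
    adjacent : ∀ i → Adj G (vertex i) (vertex (next i))

open FourCycle using (vertex)

-- A bijective labelling; the element k of Fin 16 stands for the label k + 1.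
Labelling : Set → Setoid 0ℓ 0ℓ
Labelling V = bijectionSetoid V (Fin 16)

label : {V : Set} → V ↔ Fin 16 → V → ℕ
label L v = suc (toℕ (Inverse.to L v))

∑ : (Fin 4 → ℕ) → ℕ
∑ f = sum (tabulate f)

MagicFaced : Pred (Vertex Q₄ ↔ Fin 16) 0ℓ
MagicFaced L = ∀ (c d : FourCycle Q₄) →
  ∑ (label L ∘ vertex c) ≡ ∑ (label L ∘ vertex d)

MagicFacedTesseract : Setoid 0ℓ 0ℓ
MagicFacedTesseract = subsetoid (Labelling (Vertex Q₄)) MagicFaced

Position : Set
Position = Vertex (C₄ □ C₄)

record MagicSquare (A : Position ↔ Fin 16) : Set where
  field
    row    : ∀ i → ∑ (λ j → label A (i , j)) ≡ 34
    column : ∀ j → ∑ (λ i → label A (i , j)) ≡ 34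
    block  : ∀ i j → label A (i , j)      + label A (i , next j)
                   + label A (next i , j) + label A (next i , next j) ≡ 34

MagicArrangement : Setoid 0ℓ 0ℓ
MagicArrangement = subsetoid (Labelling Position) MagicSquare

-- FQ₄ and Q₄ have the same vertices; (g · L) v = L (g⁻¹ v).
actionOnLabellings : LeftAction (Aut FQ₄) (Labelling (Vertex Q₄))
actionOnLabellings = record
  { _·_        = λ g L → L ↔-∘ ↔-sym (bijection g)
  ; ·-cong     = λ {g} {h} {L} {M} g≈h L≈M v →
      trans (L≈M (GraphIso.from g v))
        (cong (Inverse.to M) (from-cong (bijection g) (bijection h) g≈h v))
  ; ·-identity = λ _ _ → refl
  ; ·-assoc    = λ _ _ _ _ → refl
  }

-- The action above transported along φ: g · A = (g · (A ∘ φ⁻¹)) ∘ φ.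
actionOnArrangements : GraphIso (C₄ □ C₄) Q₄ →
                       LeftAction (Aut FQ₄) (Labelling Position)
actionOnArrangements φ = record
  { _·_        = λ g A → (g · (A ↔-∘ ↔-sym Φ)) ↔-∘ Φ
  ; ·-cong     = λ {g} {h} {A} {B} g≈h A≈B x →
      ·-cong {g} {h} {A ↔-∘ ↔-sym Φ} {B ↔-∘ ↔-sym Φ}
        g≈h (A≈B ∘ Inverse.from Φ) (Inverse.to Φ x)
  ; ·-identity = λ A x → cong (Inverse.to A) (Inverse.strictlyInverseʳ Φ x)
  ; ·-assoc    = λ g h A x → cong (Inverse.to A ∘ Inverse.from Φ ∘ GraphIso.from h)
      (sym (Inverse.strictlyInverseˡ Φ _))
  }
  where
  open LeftAction actionOnLabellings
  Φ = bijection φ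

{-# OPTIONS --safe #-}
module Submission where

open import Defs
open import Algebra.Bundles using (Group)
open import Data.Nat.Base using (_*_; _^_; _!)
open import Data.Product.Base using (_×_)
open import Relation.Binary.PropositionalEquality using (_≡_)

open import Algebra.Bundles using (CommutativeRing)
open import Algebra.Morphism.Structures using (module GroupMorphisms)
import Algebra.Properties.CommutativeSemigroup as CommutativeSemigroupProperties
import Algebra.Properties.Group as GroupProperties
open import Data.Bool.Base using (Bool; true; false; if_then_else_; _∧_; _xor_; not)
open import Data.Bool.Properties
  using (xor-assoc; xor-comm; xor-identityʳ; xor-identityˡ; xor-same;
         ∧-identityʳ; xor-∧-commutativeRing)
import Data.Bool.Properties as Bool
open import Data.Fin.Base
  using (Fin; toℕ; fromℕ; fromℕ<; zero; suc; punchIn; punchOut)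
open import Data.Fin.Patterns
open import Data.Fin.Permutation
  using (Permutation; remove; insert; insert-remove; remove-insert; punchIn-permute)
open import Data.Fin.Properties
  using (_≟_; all?; any?; *↔×; 2↔Bool; injective⇒≤; punchIn-injective; punchOut-injective)
import Data.Fin.Properties as Fin
open import Data.Fin.Subset using (∣_∣)
open import Data.Fin.Subset.Properties using (∣p∣≡n⇒p≡⊤)
open import Data.List.Base using (List; []; _∷_)
open import Data.List.Relation.Unary.Any using (here; there)
open import Data.Nat.Base using (ℕ; zero; suc; _+_)
import Data.Nat.Base as ℕ
import Data.Nat.Properties as ℕ
open import Data.Nat.Tactic.RingSolver using (solve-∀)
open import Data.List.Membership.DecPropositional ℕ._≟_
  using (_∈?_) renaming (_∈_ to _∈ˡ_)
open import Data.Product.Base using (∃; _,_; proj₁; proj₂)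
open import Data.Product.Function.NonDependent.Propositional using (_×-↔_)
open import Data.Product.Function.NonDependent.Setoid using (_×-inverse_)
open import Data.Product.Properties using () renaming (≡-dec to ×-≡-dec)
open import Data.Product.Relation.Binary.Pointwise.NonDependent
  using (_×ₛ_; Pointwise-≡↔≡)
open import Data.Sum.Base using (_⊎_; inj₁; inj₂)
open import Data.Vec.Base
  using (Vec; []; _∷_; head; tail; _++_; zipWith; tabulate; lookup; replicate)
open import Data.Vec.Properties
  using (≡-dec; tabulate∘lookup; lookup∘tabulate; tabulate-cong; zipWith-assoc;
         zipWith-comm; zipWith-identityˡ; zipWith-identityʳ)
open import Function.Base using (_∘_; id)
open import Function.Bundles using (Inverse; Injection; _↔_; mk↔ₛ′; mk⤖)
import Function.Construct.Composition as Composition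
import Function.Construct.Identity as Identity
import Function.Construct.Symmetry as Symmetry
open import Function.Construct.Composition using (_↔-∘_)
open import Function.Construct.Symmetry using (↔-sym)
open import Function.Definitions using (Injective; Surjective)
open import Function.Properties.Bijection using (⤖⇒↔; Bijection⇒Inverse)
open import Function.Properties.Inverse using (↔⇒↣)
open import Relation.Binary.Bundles using (Setoid)
open import Relation.Binary.PropositionalEquality
  using (_≢_; refl; sym; trans; cong; cong₂; subst; module ≡-Reasoning)
import Relation.Binary.PropositionalEquality as ≡
open import Relation.Nullary using (¬_; Dec; yes; no; contradiction)
open import Relation.Nullary.Decidable
  using (from-yes; map′; _→-dec_; _⊎-dec_; _×-dec_; ¬?)

open import Algebra.Properties.CommutativeMonoid.Sum ℕ.+-0-commutativeMonoid
  using (sum-permute) renaming (sum to sumᶠ)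

-- FQ₄ is the Cayley graph of 𝔽₂⁵ / ⟨ e₀ + ⋯ + e₄ ⟩ with respect to the images of
-- e₀, …, e₄. Opposite edges of a 4-cycle are parallel, so an automorphism permutes
-- the five directions in the same way at every vertex; hence it is affine, and
-- Aut FQ₄ ≅ C₂⁴ ⋊ S₅.
--
-- If all faces of Q₄ have the same sum, it is 34, and then all 4-cycles of FQ₄ sum
-- to 34, which is a condition invariant under Aut FQ₄. Lower all labels by one, let x
-- be the vertex with label 15 and b₀, …, b₄ the labels of its neighbours in FQ₄. Every
-- remaining vertex is x + eₚ + e_q + eᵣ with p, q, r distinct, and has label bₚ + b_q + bᵣ.
-- As 0, 1, 2, 4, 8 are not sums of three other available labels, they are the bᵢ in
-- some order, so the labelling is determined by x and a bijection between directions: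
-- Aut FQ₄ acts simply transitively.
--
-- The 4-cycles of C₄ □ C₄ are its rows, columns and 2 × 2 subsquares, so any graph
-- isomorphism C₄ □ C₄ ≅ Q₄ turns tesseracts into squares.

-- Everything rests on one fact: `Aut FQ₄` acts simply transitively on the magic-faced labellings.
-- Freeness is immediate, because a labelling is injective (`labellings-free`). Invariance is less
-- so, since an automorphism of FQ₄ need not preserve the faces of Q₄; it follows from
-- `faces⇒balanced`, by which equal face sums force the sum 34 on the cycles through antipodal edges
-- too. Transitivity is `standard-form`. Around the vertex of value 15, half of the zero-based cycle
-- sum 30, the cycle equations make the value of every vertex at distance two a sum of three
-- neighbouring values (`value-three`). `power-single` then forces the neighbouring values to be 0,
-- 1, 2, 4, 8, and the affine automorphism that matches these neighbours with those in the fixed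
-- labelling `L₀` matches all labels.
--
-- The group is found with `rectangle`: it gives an automorphism a linear part (`aut-along`), which
-- together with the image of `𝟘` determines it (`along-unique`). Conversely `affine` realises every
-- such pair, so `coordinates` is an isomorphism and the order is 16 · 5! = 1920. The orbit of `L₀`
-- transfers this number to tesseracts, and `arrangements↔tesseracts` to squares.

open Graph
open FourCycle using (vertex; distinct; adjacent)

-- Permutations of Fin n

to-injective : ∀ {A B : Set} (f : A ↔ B) → Injective _≡_ _≡_ (Inverse.to f)
to-injective f = Injection.injective (↔⇒↣ f)

-- Pigeonhole: if `j` were missed, punching it out of the target would inject `Fin (suc n)` into
-- `Fin n`.
injective⇒surjective : ∀ {n} {f : Fin n → Fin n} →
                       Injective _≡_ _≡_ f → ∀ j → ∃ λ i → f i ≡ j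
injective⇒surjective {suc n} {f} f-injective j with any? (λ i → f i ≟ j)
... | yes hit = hit
... | no miss = contradiction
  (injective⇒≤ {f = λ i → punchOut (missed i)} λ {i} {k} eq →
    f-injective (punchOut-injective (missed i) (missed k) eq))
  ℕ.1+n≰n
  where
  missed : ∀ i → j ≢ f i
  missed i j≡fi = miss (i , sym j≡fi)

injective⇒↔ : ∀ {n} {f : Fin n → Fin n} → Injective _≡_ _≡_ f → Fin n ↔ Fin n
injective⇒↔ {f = f} f-injective = ⤖⇒↔ (mk⤖ (f-injective , λ j →
  let i , fi≡j = injective⇒surjective f-injective j in i , λ { refl → fi≡j }))

-- A permutation amounts to the image of `0F` and the permutation left after deleting `0F` and its
-- image, which gives the factor `suc n`.
∣Sₙ∣≡n! : ∀ n → HasCardinality (bijectionSetoid (Fin n) (Fin n)) (n !)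
∣Sₙ∣≡n! zero = record
  { to        = λ _ → 0F
  ; from      = λ _ → Identity.↔-id _
  ; to-cong   = λ _ → refl
  ; from-cong = λ _ → λ ()
  ; inverse   = (λ { {0F} _ → refl }) , (λ _ → λ ())
  }
∣Sₙ∣≡n! (suc n) =
  Composition.inverse remove₀
    (Composition.inverse (Identity.inverse _ ×-inverse ∣Sₙ∣≡n! n)
      (Composition.inverse Pointwise-≡↔≡ (↔-sym *↔×)))
  where
  remove-cong : ∀ (π ρ : Permutation (suc n) (suc n)) →
                (∀ i → Inverse.to π i ≡ Inverse.to ρ i) →
                ∀ i → Inverse.to (remove 0F π) i ≡ Inverse.to (remove 0F ρ) i
  remove-cong π ρ π≈ρ i = punchIn-injective (Inverse.to ρ 0F) _ _
    (trans (cong (λ j → punchIn j (Inverse.to (remove 0F π) i)) (sym (π≈ρ 0F)))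
      (trans (sym (punchIn-permute π 0F i))
        (trans (π≈ρ (suc i)) (punchIn-permute ρ 0F i))))

  insert-cong : ∀ {j k} (π ρ : Permutation n n) → j ≡ k →
                (∀ i → Inverse.to π i ≡ Inverse.to ρ i) →
                ∀ i → Inverse.to (insert 0F j π) i ≡ Inverse.to (insert 0F k ρ) i
  insert-cong π ρ j≡k π≈ρ zero    = j≡k
  insert-cong π ρ j≡k π≈ρ (suc i) = cong₂ punchIn j≡k (π≈ρ i)

  remove₀ : Inverse (bijectionSetoid (Fin (suc n)) (Fin (suc n)))
                    (≡.setoid (Fin (suc n)) ×ₛ bijectionSetoid (Fin n) (Fin n))
  remove₀ = record
    { to        = λ π → Inverse.to π 0F , remove 0F π
    ; from      = λ (j , π) → insert 0F j π
    ; to-cong   = λ {π} {ρ} π≈ρ → π≈ρ 0F , remove-cong π ρ π≈ρ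
    ; from-cong = λ {(_ , π)} {(_ , ρ)} (j≡k , π≈ρ) → insert-cong π ρ j≡k π≈ρ
    ; inverse   =
        (λ {(j , π)} {ρ} eq → eq 0F , λ i →
          trans (remove-cong ρ (insert 0F j π) eq i) (remove-insert 0F j π i)) ,
        (λ {π} {(j , ρ)} (j≡ , ρ≈) i →
          trans (insert-cong ρ (remove 0F π) j≡ ρ≈ i) (insert-remove 0F π i))
    }

-- FQ₄ as a Cayley graph

V : Set
V = Vertex Q₄

infixl 6 _⊕_ _▸_

opaque
  _⊕_ : V → V → V
  _⊕_ = zipWith _xor_

𝟘 : V
𝟘 = replicate 4 false

-- Identifies 𝔽₂⁵ / ⟨ e₀ + ⋯ + e₄ ⟩ with `V`: adding `x 0F` times the all-ones vector clears
-- coordinate 0, and the other four coordinates name the class.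
project : (Fin 5 → Bool) → V
project x = tabulate λ i → x 0F xor x (suc i)

section : V → Fin 5 → Bool
section v zero    = false
section v (suc i) = lookup v i

project-section : ∀ v → project (section v) ≡ v
project-section = tabulate∘lookup

δ : Fin 5 → V
δ k = project (e k)

-- The edges of FQ₄ leave a vertex in five directions: direction 0 leads to the
-- antipode and direction suc i flips coordinate i.
opaque
  _▸_ : V → Fin 5 → V
  v ▸ k = v ⊕ δ k

opaque
  unfolding _⊕_

  ⊕-assoc : ∀ u v w → u ⊕ v ⊕ w ≡ u ⊕ (v ⊕ w)
  ⊕-assoc = zipWith-assoc xor-assoc

  ⊕-comm : ∀ u v → u ⊕ v ≡ v ⊕ u
  ⊕-comm = zipWith-comm xor-comm

  ⊕-identityˡ : ∀ v → 𝟘 ⊕ v ≡ v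
  ⊕-identityˡ = zipWith-identityˡ xor-identityˡ

  ⊕-identityʳ : ∀ v → v ⊕ 𝟘 ≡ v
  ⊕-identityʳ = zipWith-identityʳ xor-identityʳ

  ⊕-self : ∀ v → v ⊕ v ≡ 𝟘
  ⊕-self (a ∷ b ∷ c ∷ d ∷ [])
    rewrite xor-same a | xor-same b | xor-same c | xor-same d = refl

⊕-cancelˡ : ∀ u v → u ⊕ (u ⊕ v) ≡ v
⊕-cancelˡ u v =
  trans (sym (⊕-assoc u u v)) (trans (cong (_⊕ v) (⊕-self u)) (⊕-identityˡ v))

⊕-injectiveʳ : ∀ u {v w} → u ⊕ v ≡ u ⊕ w → v ≡ w
⊕-injectiveʳ u {v} {w} eq =
  trans (sym (⊕-cancelˡ u v)) (trans (cong (u ⊕_) eq) (⊕-cancelˡ u w))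

opaque
  unfolding _▸_

  ⊕-▸ : ∀ u v k → u ⊕ (v ▸ k) ≡ u ⊕ v ▸ k
  ⊕-▸ u v k = sym (⊕-assoc u v (δ k))

  ▸-comm : ∀ v i j → v ▸ i ▸ j ≡ v ▸ j ▸ i
  ▸-comm v i j =
    trans (⊕-assoc v (δ i) (δ j))
      (trans (cong (v ⊕_) (⊕-comm (δ i) (δ j))) (sym (⊕-assoc v (δ j) (δ i))))

  ▸-involutive : ∀ v k → v ▸ k ▸ k ≡ v
  ▸-involutive v k =
    trans (⊕-assoc v (δ k) (δ k)) (trans (cong (v ⊕_) (⊕-self (δ k))) (⊕-identityʳ v))

▸-cancel : ∀ {u v} k → u ▸ k ≡ v ▸ k → u ≡ v
▸-cancel {u} {v} k eq =
  trans (sym (▸-involutive u k)) (trans (cong (_▸ k) eq) (▸-involutive v k))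

_≟ⱽ_ : ∀ (u v : V) → Dec (u ≡ v)
_≟ⱽ_ = ≡-dec Bool._≟_

opaque
  unfolding _▸_ _⊕_

  ▸-injective : ∀ v {i j} → v ▸ i ≡ v ▸ j → i ≡ j
  ▸-injective v {i} {j} eq = table i j (⊕-injectiveʳ v eq)
    where
    table : ∀ i j → δ i ≡ δ j → i ≡ j
    table = from-yes (all? λ i → all? λ j →
      (δ i ≟ⱽ δ j) →-dec (i ≟ j))

  -- Two distinct directions a and c out of v span exactly one 4-cycle through v.
  rectangle : ∀ v {a b c d} → v ▸ a ▸ b ≡ v ▸ c ▸ d → a ≢ c →
              a ≡ b ⊎ a ≡ d × b ≡ c
  rectangle v {a} {b} {c} {d} eq = table a b c d
    (⊕-injectiveʳ v (trans (sym (⊕-assoc v (δ a) (δ b))) (trans eq (⊕-assoc v (δ c) (δ d)))))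
    where
    table : ∀ a b c d →
            δ a ⊕ δ b ≡ δ c ⊕ δ d →
            a ≢ c → a ≡ b ⊎ a ≡ d × b ≡ c
    table = from-yes (all? λ a → all? λ b → all? λ c → all? λ d →
      ((δ a ⊕ δ b) ≟ⱽ (δ c ⊕ δ d)) →-dec
      (¬? (a ≟ c) →-dec ((a ≟ b) ⊎-dec ((a ≟ d) ×-dec (b ≟ c)))))

opaque
  unfolding _▸_ _⊕_

  -- Induction along edges: directions 1 to 4 flip single coordinates, so every vertex is reached
  -- from `𝟘`.
  span : ∀ {p} (P : V → Set p) → P 𝟘 → (∀ v k → P v → P (v ▸ k)) → ∀ v → P v
  span P P𝟘 step (a ∷ b ∷ c ∷ d ∷ []) =
    subst P flips≡ (flip d 4F (flip c 3F (flip b 2F (flip a 1F P𝟘))))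
    where
    flip : ∀ x {v} k → P v → P (if x then v ▸ k else v)
    flip true  {v} k Pv = step v k Pv
    flip false     k Pv = Pv

    flips : Bool → Bool → Bool → Bool → V
    flips a b c d =
      let v₁ = if a then 𝟘 ▸ 1F else 𝟘
          v₂ = if b then v₁ ▸ 2F else v₁
          v₃ = if c then v₂ ▸ 3F else v₂
      in  if d then v₃ ▸ 4F else v₃

    flips≡ : ∀ {a b c d} → flips a b c d ≡ a ∷ b ∷ c ∷ d ∷ []
    flips≡ {false} {false} {false} {false} = refl
    flips≡ {false} {false} {false} {true}  = refl
    flips≡ {false} {false} {true}  {false} = refl
    flips≡ {false} {false} {true}  {true}  = refl
    flips≡ {false} {true}  {false} {false} = refl
    flips≡ {false} {true}  {false} {true}  = refl
    flips≡ {false} {true}  {true}  {false} = refl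
    flips≡ {false} {true}  {true}  {true}  = refl
    flips≡ {true}  {false} {false} {false} = refl
    flips≡ {true}  {false} {false} {true}  = refl
    flips≡ {true}  {false} {true}  {false} = refl
    flips≡ {true}  {false} {true}  {true}  = refl
    flips≡ {true}  {true}  {false} {false} = refl
    flips≡ {true}  {true}  {false} {true}  = refl
    flips≡ {true}  {true}  {true}  {false} = refl
    flips≡ {true}  {true}  {true}  {true}  = refl

weight-one : ∀ (w : V) → ∣ w ∣ ≡ 1 → ∃ λ i → w ≡ δ (suc i)
weight-one (true ∷ false ∷ false ∷ false ∷ []) _ = 0F , refl
weight-one (false ∷ true ∷ false ∷ false ∷ []) _ = 1F , refl
weight-one (false ∷ false ∷ true ∷ false ∷ []) _ = 2F , refl
weight-one (false ∷ false ∷ false ∷ true ∷ []) _ = 3F , refl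

opaque
  unfolding _▸_ _⊕_

  Q₄-adj⇒▸ : ∀ {u v} → Adj Q₄ u v → ∃ λ i → v ≡ u ▸ suc i
  Q₄-adj⇒▸ {u} {v} uv =
    let i , w≡ = weight-one (u ⊕ v) uv
    in  i , trans (sym (⊕-cancelˡ u v)) (cong (u ⊕_) w≡)

  ▸⇒Q₄-adj : ∀ v i → Adj Q₄ v (v ▸ suc i)
  ▸⇒Q₄-adj v i = trans (cong ∣_∣ (⊕-cancelˡ v (δ (suc i)))) (table i)
    where
    table : ∀ i → ∣ δ (suc i) ∣ ≡ 1
    table = from-yes (all? λ i → ∣ δ (suc i) ∣ ℕ.≟ 1)

  FQ₄-adj⇒▸ : ∀ {u v} → Adj FQ₄ u v → ∃ λ k → v ≡ u ▸ k
  FQ₄-adj⇒▸ {u} {v} (inj₁ uv) = let i , v≡ = Q₄-adj⇒▸ {u} uv in suc i , v≡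
  FQ₄-adj⇒▸ {u} {v} (inj₂ uv) =
    -- A difference of weight four is the all-true vector, which is `δ 0F`.
    0F , trans (sym (⊕-cancelˡ u v)) (cong (u ⊕_) (∣p∣≡n⇒p≡⊤ {p = u ⊕ v} uv))

  ▸⇒FQ₄-adj : ∀ v k → Adj FQ₄ v (v ▸ k)
  ▸⇒FQ₄-adj v zero    = inj₂ (cong ∣_∣ (⊕-cancelˡ v (δ 0F)))
  ▸⇒FQ₄-adj v (suc i) = inj₁ (▸⇒Q₄-adj v i)

-- The maps f with a well-defined linear part, given by its action σ on the five
-- directions.
record Along (σ : Fin 5 → Fin 5) (f : V → V) : Set where
  constructor along
  field
    equivariant : ∀ v k → f (v ▸ k) ≡ f v ▸ σ k

open Along

-- Agreement at one vertex spreads along edges, and FQ₄ is connected.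
along-unique : ∀ {σ τ f g} → Along σ f → Along τ g → (∀ k → σ k ≡ τ k) →
               f 𝟘 ≡ g 𝟘 → ∀ v → f v ≡ g v
along-unique {σ} {τ} {f} {g} f-along g-along σ≗τ f𝟘≡g𝟘 =
  span (λ v → f v ≡ g v) f𝟘≡g𝟘 λ v k fv≡gv → begin
    f (v ▸ k)  ≡⟨ equivariant f-along v k ⟩
    f v ▸ σ k  ≡⟨ cong₂ _▸_ fv≡gv (σ≗τ k) ⟩
    g v ▸ τ k  ≡⟨ equivariant g-along v k ⟨
    g (v ▸ k)  ∎
  where open ≡-Reasoning

along-∘ : ∀ {σ τ f g} → Along σ f → Along τ g → Along (σ ∘ τ) (f ∘ g)
along-∘ {τ = τ} {f} {g} f-along g-along = along λ v k →
  trans (cong f (equivariant g-along v k)) (equivariant f-along (g v) (τ k))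

along-id : Along id id
along-id = along λ _ _ → refl

-- Affine maps of 𝔽₂⁵ / ⟨ e₀ + ⋯ + e₄ ⟩

open Group C₂⁴ using () renaming (_≈_ to _~_)

xor-exchange : ∀ a b c d → a xor b ≡ c xor d → b xor d ≡ a xor c
xor-exchange false false false false _ = refl
xor-exchange false false true  true  _ = refl
xor-exchange false true  false true  _ = refl
xor-exchange false true  true  false _ = refl
xor-exchange true  false false true  _ = refl
xor-exchange true  false true  false _ = refl
xor-exchange true  true  false false _ = refl
xor-exchange true  true  true  true  _ = refl

e₀+⋯+e₄≗true : ∀ i → e₀+⋯+e₄ i ≡ true
e₀+⋯+e₄≗true = from-yes (all? λ i → e₀+⋯+e₄ i Bool.≟ true)

-- Equal projections mean that `x` and `y` differ by the same bit in every coordinate, that is, by a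
-- multiple of the all-ones vector.
project-injective : ∀ {x y} → project x ≡ project y → x ~ y
project-injective {x} {y} eq = x 0F xor y 0F , λ i →
  trans (difference i)
    (sym (trans (cong ((x 0F xor y 0F) ∧_) (e₀+⋯+e₄≗true i)) (∧-identityʳ _)))
  where
  difference : ∀ i → x i xor y i ≡ x 0F xor y 0F
  difference zero    = refl
  difference (suc i) = xor-exchange (x 0F) (x (suc i)) (y 0F) (y (suc i))
    (tabulate-injective {f = λ i → x 0F xor x (suc i)} {λ i → y 0F xor y (suc i)} eq i)
    where
    tabulate-injective : ∀ {n} {f g : Fin n → Bool} →
                         tabulate f ≡ tabulate g → ∀ i → f i ≡ g i
    tabulate-injective eq i =
      trans (sym (lookup∘tabulate _ i))
        (trans (cong (λ v → lookup v i) eq) (lookup∘tabulate _ i))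

project-cong : ∀ {x y} → x ~ y → project x ≡ project y
project-cong {x} {y} (k , x~y) = tabulate-cong λ i →
  xor-exchange (y 0F) (x 0F) (y (suc i)) (x (suc i))
    (trans (xor-comm (y 0F) (x 0F)) (trans (difference 0F)
      (trans (sym (difference (suc i))) (xor-comm (x (suc i)) (y (suc i))))))
  where
  difference : ∀ i → x i xor y i ≡ k
  difference i =
    trans (x~y i) (trans (cong (k ∧_) (e₀+⋯+e₄≗true i)) (∧-identityʳ k))

xor-interchange : ∀ a b c d → (a xor b) xor (c xor d) ≡ (a xor c) xor (b xor d)
xor-interchange = CommutativeSemigroupProperties.interchange
  (CommutativeRing.+-commutativeSemigroup xor-∧-commutativeRing)

opaque
  unfolding _⊕_

  project-+ : ∀ x y → project (λ i → x i xor y i) ≡ project x ⊕ project y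
  project-+ x y =
    cong₂ _∷_ (at 0F) (cong₂ _∷_ (at 1F) (cong₂ _∷_ (at 2F) (cong (_∷ []) (at 3F))))
    where
    at : ∀ (i : Fin 4) → (x 0F xor y 0F) xor (x (suc i) xor y (suc i))
                       ≡ (x 0F xor x (suc i)) xor (y 0F xor y (suc i))
    at i = xor-interchange (x 0F) (y 0F) (x (suc i)) (y (suc i))

linear : Fin 5 ↔ Fin 5 → V → V
linear σ v = project (section v ∘ Inverse.from σ)

linear-𝟘 : ∀ σ → linear σ 𝟘 ≡ 𝟘
linear-𝟘 σ = project-cong {section 𝟘 ∘ Inverse.from σ} {λ _ → false}
  (false , λ i → trans (xor-identityʳ _) (section-𝟘 (Inverse.from σ i)))
  where
  section-𝟘 : ∀ i → section 𝟘 i ≡ false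
  section-𝟘 = from-yes (all? λ i → section 𝟘 i Bool.≟ false)

-- Independence of the lift: two lifts differ by a multiple of the all-ones vector, which every
-- permutation of coordinates fixes.
linear-project : ∀ σ x → linear σ (project x) ≡ project (x ∘ Inverse.from σ)
linear-project σ x =
  let k , x~ = project-injective {section (project x)} {x} (project-section (project x))
  in  project-cong {section (project x) ∘ Inverse.from σ} {x ∘ Inverse.from σ}
        (k , λ i → trans (x~ (Inverse.from σ i))
          (cong (k ∧_) (trans (e₀+⋯+e₄≗true (Inverse.from σ i)) (sym (e₀+⋯+e₄≗true i)))))

opaque
  unfolding _▸_

  -- `linear σ` is additive and sends the class of `e k` to that of `e (σ k)`.
  linear-along : ∀ σ → Along (Inverse.to σ) (linear σ)
  linear-along σ = along λ v k → begin
    linear σ (v ▸ k)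
      ≡⟨ cong (λ u → linear σ (u ▸ k)) (project-section v) ⟨
    linear σ (project (section v) ⊕ δ k)
      ≡⟨ cong (linear σ) (project-+ (section v) (e k)) ⟨
    linear σ (project (λ i → section v i xor e k i))
      ≡⟨ linear-project σ (λ i → section v i xor e k i) ⟩
    project (λ i → section v (from i) xor e k (from i))
      ≡⟨ project-+ (section v ∘ from) (e k ∘ from) ⟩
    linear σ v ⊕ project (e k ∘ from)
      ≡⟨ cong (linear σ v ⊕_) (project-≗ {e k ∘ from} {e (to k)} (e-permuted k)) ⟩
    linear σ v ▸ to k ∎
    where
    open ≡-Reasoning
    open Inverse σ using (to; from)
    project-≗ : ∀ {x y : Fin 5 → Bool} → (∀ i → x i ≡ y i) → project x ≡ project y
    project-≗ x≗y = tabulate-cong λ i → cong₂ _xor_ (x≗y 0F) (x≗y (suc i))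
    e-permuted : ∀ k i → e k (from i) ≡ e (to k) i
    e-permuted k i with k ≟ from i | to k ≟ i
    ... | yes _    | yes _    = refl
    ... | no _     | no _     = refl
    ... | yes refl | no ≢i    = contradiction (Inverse.strictlyInverseˡ σ i) ≢i
    ... | no ≢from | yes refl = contradiction (sym (Inverse.strictlyInverseʳ σ k)) ≢from

linear-inverse : ∀ σ v → linear (↔-sym σ) (linear σ v) ≡ v
linear-inverse σ =
  along-unique {f = linear (↔-sym σ) ∘ linear σ} {g = id}
    (along-∘ (linear-along (↔-sym σ)) (linear-along σ)) along-id
    (Inverse.strictlyInverseʳ σ)
    (trans (cong (linear (↔-sym σ)) (linear-𝟘 σ)) (linear-𝟘 (↔-sym σ)))

-- In characteristic two the translation by `t` is its own inverse, so undoing it is again `t ⊕_`.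
affine : V → Fin 5 ↔ Fin 5 → V ↔ V
affine t σ = mk↔ₛ′ (λ v → t ⊕ linear σ v) (λ v → linear (↔-sym σ) (t ⊕ v))
  (λ v → trans (cong (t ⊕_) (linear-inverse (↔-sym σ) (t ⊕ v))) (⊕-cancelˡ t v))
  (λ v → trans (cong (linear (↔-sym σ)) (⊕-cancelˡ t (linear σ v))) (linear-inverse σ v))

affine-along : ∀ t σ → Along (Inverse.to σ) (Inverse.to (affine t σ))
affine-along t σ = along λ v k →
  trans (cong (t ⊕_) (equivariant (linear-along σ) v k)) (⊕-▸ t (linear σ v) (Inverse.to σ k))

-- Automorphisms of FQ₄

module _ (g : GraphIso FQ₄ FQ₄) where
  open GraphIso g using (to; preserves; bijection)
  open ≡-Reasoning

  private
    neighbour : ∀ v k → ∃ λ i → to (v ▸ k) ≡ to v ▸ i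
    neighbour v k =
      FQ₄-adj⇒▸ {to v} {to (v ▸ k)} (preserves {v} {v ▸ k} (▸⇒FQ₄-adj v k))

    directionAt : V → Fin 5 → Fin 5
    directionAt v k = proj₁ (neighbour v k)

    two-steps : ∀ v j k →
                to (v ▸ j ▸ k) ≡ to v ▸ directionAt v j ▸ directionAt (v ▸ j) k
    two-steps v j k = trans (proj₂ (neighbour (v ▸ j) k))
      (cong (_▸ directionAt (v ▸ j) k) (proj₂ (neighbour v j)))

    directionAt-injective : ∀ v {j k} → directionAt v j ≡ directionAt v k → j ≡ k
    directionAt-injective v {j} {k} eq = ▸-injective v (to-injective bijection
      (trans (proj₂ (neighbour v j))
        (trans (cong (to v ▸_) eq) (sym (proj₂ (neighbour v k))))))

    -- A 4-cycle is mapped to a 4-cycle, whose opposite edges are parallel.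
    directionAt-▸ : ∀ v j k → directionAt (v ▸ j) k ≡ directionAt v k
    directionAt-▸ v j k with j ≟ k
    -- Here the second step runs back along the first edge, whose image is the same edge reversed.
    ... | yes refl = sym (▸-injective (to (v ▸ k)) (begin
      to (v ▸ k) ▸ directionAt v k
        ≡⟨ cong (_▸ directionAt v k) (proj₂ (neighbour v k)) ⟩
      to v ▸ directionAt v k ▸ directionAt v k
        ≡⟨ ▸-involutive (to v) (directionAt v k) ⟩
      to v                   ≡⟨ cong to (▸-involutive v k) ⟨
      to (v ▸ k ▸ k)         ≡⟨ proj₂ (neighbour (v ▸ k) k) ⟩
      to (v ▸ k) ▸ directionAt (v ▸ k) k ∎))
    ... | no j≢k with rectangle (to v)
      (trans (sym (two-steps v j k)) (trans (cong to (▸-comm v j k)) (two-steps v k j)))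
      (j≢k ∘ directionAt-injective v)
    ...   | inj₂ (_ , b≡c) = b≡c
    -- If the image retraced its first step, `v ▸ j ▸ k` and `v ▸ j ▸ j` would have the same image.
    ...   | inj₁ a≡b = contradiction
      (sym (▸-injective (v ▸ j) (to-injective bijection (begin
        to (v ▸ j ▸ k)   ≡⟨ two-steps v j k ⟩
        to v ▸ directionAt v j ▸ directionAt (v ▸ j) k
          ≡⟨ cong (to v ▸ directionAt v j ▸_) a≡b ⟨
        to v ▸ directionAt v j ▸ directionAt v j
          ≡⟨ ▸-involutive (to v) (directionAt v j) ⟩
        to v             ≡⟨ cong to (▸-involutive v j) ⟨
        to (v ▸ j ▸ j)   ∎))))
      j≢k

    directionAt-const : ∀ v k → directionAt v k ≡ directionAt 𝟘 k
    directionAt-const = span (λ v → ∀ k → directionAt v k ≡ directionAt 𝟘 k)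
      (λ _ → refl) λ v j const k → trans (directionAt-▸ v j k) (const k)

  linearPart : Fin 5 ↔ Fin 5
  linearPart = injective⇒↔ (directionAt-injective 𝟘)

  aut-along : Along (Inverse.to linearPart) to
  aut-along = along λ v k →
    trans (proj₂ (neighbour v k)) (cong (to v ▸_) (directionAt-const v k))

  -- Used to compute the linear part of a product or of an equal automorphism: exhibiting any
  -- `Along` suffices.
  linearPart-unique : ∀ {σ} → Along σ to → ∀ k → Inverse.to linearPart k ≡ σ k
  linearPart-unique to-along k =
    ▸-injective (to 𝟘) (trans (sym (equivariant aut-along 𝟘 k)) (equivariant to-along 𝟘 k))

  aut-affine : ∀ v → to v ≡ to 𝟘 ⊕ linear linearPart v
  aut-affine = along-unique aut-along (affine-along (to 𝟘) linearPart) (λ _ → refl)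
    (sym (trans (cong (to 𝟘 ⊕_) (linear-𝟘 linearPart)) (⊕-identityʳ (to 𝟘))))

along⇒aut : ∀ (f : V ↔ V) (σ : Fin 5 ↔ Fin 5) →
            Along (Inverse.to σ) (Inverse.to f) → GraphIso FQ₄ FQ₄
along⇒aut f σ f-along = record
  { bijection = f
  ; preserves = λ {u} {v} uv →
      let k , v≡ = FQ₄-adj⇒▸ {u} {v} uv
      in  subst (Adj FQ₄ (to u)) (sym (trans (cong to v≡) (equivariant f-along u k)))
            (▸⇒FQ₄-adj (to u) (Inverse.to σ k))
  ; reflects  = λ {u} {v} uv →
      let k , v≡ = FQ₄-adj⇒▸ {to u} {to v} uv
          j = Inverse.from σ k
      in  subst (Adj FQ₄ u)
            (sym (to-injective f (trans v≡ (sym (trans (equivariant f-along u j)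
              (cong (to u ▸_) (Inverse.strictlyInverseˡ σ k)))))))
            (▸⇒FQ₄-adj u j)
  }
  where open Inverse f using (to)

affineAut : V → Fin 5 ↔ Fin 5 → GraphIso FQ₄ FQ₄
affineAut t σ = along⇒aut (affine t σ) σ (affine-along t σ)

affine-𝟘 : ∀ t σ → Inverse.to (affine t σ) 𝟘 ≡ t
affine-𝟘 t σ = trans (cong (t ⊕_) (linear-𝟘 σ)) (⊕-identityʳ t)

-- The isomorphism with C₂⁴ ⋊ S₅ and the order of the group

module _ {a b ℓ₁ ℓ₂} (G : Group a ℓ₁) (H : Group b ℓ₂) where
  private
    module G = Group G
    module H = Group H
  open GroupProperties H using (identityˡ-unique; inverseˡ-unique)
  open GroupMorphisms G.rawGroup H.rawGroup using (IsGroupHomomorphism)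

  multiplicative⇒homomorphism :
    (f : G.Carrier → H.Carrier) →
    (∀ {x y} → x G.≈ y → f x H.≈ f y) →
    (∀ x y → f (x G.∙ y) H.≈ (f x H.∙ f y)) →
    IsGroupHomomorphism f
  multiplicative⇒homomorphism f f-cong f-∙ = record
    { isMonoidHomomorphism = record
      { isMagmaHomomorphism = record
        { isRelHomomorphism = record { cong = f-cong }
        ; homo              = f-∙
        }
      ; ε-homo = f-ε
      }
    ; ⁻¹-homo = λ x → inverseˡ-unique (f (x G.⁻¹)) (f x)
        (H.trans (H.sym (f-∙ (x G.⁻¹) x)) (H.trans (f-cong (G.inverseˡ x)) f-ε))
    }
    where
    f-ε : f G.ε H.≈ H.ε
    f-ε = identityˡ-unique (f G.ε) (f G.ε)
      (H.trans (H.sym (f-∙ G.ε G.ε)) (f-cong (G.identityˡ G.ε)))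

open Group (Aut FQ₄) using () renaming (_≈_ to _≈ᴬ_; _∙_ to _∙ᴬ_)
open Group C₂⁴⋊S₅ using () renaming (Carrier to AffineMap; _≈_ to _≈⋊_; _∙_ to _∙⋊_)

coordinates : GraphIso FQ₄ FQ₄ → AffineMap
coordinates g = section (GraphIso.to g 𝟘) , linearPart g

section-~ : ∀ {x v} → v ≡ project x → section v ~ x
section-~ {x} {v} v≡ = project-injective {section v} {x} (trans (project-section v) v≡)

coordinates-cong : ∀ {g h} → g ≈ᴬ h → coordinates g ≈⋊ coordinates h
coordinates-cong {g} {h} g≈h =
  section-~ {section (GraphIso.to h 𝟘)} (trans (g≈h 𝟘) (sym (project-section _))) ,
  linearPart-unique g (along λ v k →
    trans (g≈h (v ▸ k)) (trans (equivariant (aut-along h) v k)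
      (cong (_▸ Inverse.to (linearPart h) k) (sym (g≈h v)))))

-- The composite sends `𝟘` to the translation of `g` plus its linear part applied to the translation
-- of `h`, which is the semidirect product law.
coordinates-∙ : ∀ g h → coordinates (g ∙ᴬ h) ≈⋊ (coordinates g ∙⋊ coordinates h)
coordinates-∙ g h =
  section-~ {λ i → section (GraphIso.to g 𝟘) i
                   xor section (GraphIso.to h 𝟘) (Inverse.from (linearPart g) i)}
    (begin
      GraphIso.to g (GraphIso.to h 𝟘)
        ≡⟨ aut-affine g (GraphIso.to h 𝟘) ⟩
      GraphIso.to g 𝟘 ⊕ linear (linearPart g) (GraphIso.to h 𝟘)
        ≡⟨ cong (_⊕ linear (linearPart g) (GraphIso.to h 𝟘))
             (project-section (GraphIso.to g 𝟘)) ⟨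
      project (section (GraphIso.to g 𝟘)) ⊕ linear (linearPart g) (GraphIso.to h 𝟘)
        ≡⟨ project-+ (section (GraphIso.to g 𝟘))
                     (section (GraphIso.to h 𝟘) ∘ Inverse.from (linearPart g)) ⟨
      project (λ i → section (GraphIso.to g 𝟘) i
                     xor section (GraphIso.to h 𝟘) (Inverse.from (linearPart g) i)) ∎) ,
  linearPart-unique (g ∙ᴬ h) (along-∘ (aut-along g) (aut-along h))
  where open ≡-Reasoning

coordinates-injective : ∀ {g h} → coordinates g ≈⋊ coordinates h → g ≈ᴬ h
coordinates-injective {g} {h} (𝟘~ , σ≗τ) =
  along-unique (aut-along g) (aut-along h) σ≗τ
    (trans (sym (project-section _))
      (trans (project-cong {section (GraphIso.to g 𝟘)} {section (GraphIso.to h 𝟘)} 𝟘~)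
        (project-section _)))

coordinates-surjective : Surjective _≈ᴬ_ _≈⋊_ coordinates
coordinates-surjective (x , σ) = g , λ {h} h≈g →
  section-~ {x} (trans (h≈g 𝟘) (affine-𝟘 (project x) σ)) ,
  λ k → trans (proj₂ (coordinates-cong {h} {g} h≈g) k)
          (linearPart-unique g (affine-along (project x) σ) k)
  where g = affineAut (project x) σ

Aut[FQ₄]≅C₂⁴⋊S₅ : Aut FQ₄ ≅ᴳ C₂⁴⋊S₅
Aut[FQ₄]≅C₂⁴⋊S₅ = coordinates , record
  { isGroupMonomorphism = record
    { isGroupHomomorphism = multiplicative⇒homomorphism (Aut FQ₄) C₂⁴⋊S₅ coordinates
        (λ {g} {h} → coordinates-cong {g} {h}) coordinates-∙
    ; injective = λ {g} {h} → coordinates-injective {g} {h}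
    }
  ; surjective = coordinates-surjective
  }

Vec-Bool↔Fin : ∀ n → Vec Bool n ↔ Fin (2 ^ n)
Vec-Bool↔Fin zero = mk↔ₛ′ (λ _ → 0F) (λ _ → [])
  (λ { 0F → refl ; (suc ()) }) (λ { [] → refl })
Vec-Bool↔Fin (suc n) = ↔-sym *↔× ↔-∘ ((↔-sym 2↔Bool ×-↔ Vec-Bool↔Fin n) ↔-∘ uncons)
  where
  uncons : Vec Bool (suc n) ↔ (Bool × Vec Bool n)
  uncons = mk↔ₛ′ (λ v → head v , tail v) (λ (b , v) → b ∷ v)
    (λ _ → refl) (λ { (_ ∷ _) → refl })

∣C₂⁴∣≡16 : HasCardinality (Group.setoid C₂⁴) 16
∣C₂⁴∣≡16 = Composition.inverse {S = ≡.setoid V} (record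
  { to        = project
  ; from      = section
  ; to-cong   = λ {x} {y} → project-cong {x} {y}
  ; from-cong = λ { {v} refl → Group.refl C₂⁴ {section v} }
  ; inverse   =
      (λ {v} {x} x~ → trans (project-cong {x} {section v} x~) (project-section v)) ,
      (λ {x} {v} v≡ → section-~ {x} v≡)
  }) (Vec-Bool↔Fin 4)

∣Aut[FQ₄]∣≡1920 : HasCardinality (Group.setoid (Aut FQ₄)) 1920
∣Aut[FQ₄]∣≡1920 =
  Composition.inverse {S = Group.setoid C₂⁴⋊S₅}
    (Bijection⇒Inverse (record
      { to        = coordinates
      ; cong      = λ {g} {h} → coordinates-cong {g} {h}
      ; bijective = (λ {g} {h} → coordinates-injective {g} {h}) , coordinates-surjective
      }))
    (Composition.inverse (∣C₂⁴∣≡16 ×-inverse ∣Sₙ∣≡n! 5)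
      (Composition.inverse Pointwise-≡↔≡ (↔-sym *↔×)))

-- Four-cycles and face sums

corners : ∀ {a} {A : Set a} → A → A → A → A → Fin 4 → A
corners p q r s 0F = p
corners p q r s 1F = q
corners p q r s 2F = r
corners p q r s 3F = s

module _ (G : Graph) where

  -- Looplessness separates consecutive corners, so only the two diagonals need hypotheses.
  fourCycle : ∀ {p q r s} → Adj G p q → Adj G q r → Adj G r s → Adj G s p →
              p ≢ r → q ≢ s → FourCycle G
  fourCycle {p} {q} {r} {s} pq qr rs sp p≢r q≢s = record
    { vertex   = corners p q r s
    ; distinct = λ {i} {j} → corners-injective i j
    ; adjacent = λ { 0F → pq ; 1F → qr ; 2F → rs ; 3F → sp }
    }
    where
    distinct-ends : ∀ {u v} → Adj G u v → u ≢ v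
    distinct-ends uv u≡v = loopless G u≡v uv

    corners-injective : ∀ i j → corners p q r s i ≡ corners p q r s j → i ≡ j
    corners-injective 0F 0F _  = refl
    corners-injective 0F 1F eq = contradiction eq (distinct-ends pq)
    corners-injective 0F 2F eq = contradiction eq p≢r
    corners-injective 0F 3F eq = contradiction (sym eq) (distinct-ends sp)
    corners-injective 1F 0F eq = contradiction (sym eq) (distinct-ends pq)
    corners-injective 1F 1F _  = refl
    corners-injective 1F 2F eq = contradiction eq (distinct-ends qr)
    corners-injective 1F 3F eq = contradiction eq q≢s
    corners-injective 2F 0F eq = contradiction (sym eq) p≢r
    corners-injective 2F 1F eq = contradiction (sym eq) (distinct-ends qr)
    corners-injective 2F 2F _  = refl
    corners-injective 2F 3F eq = contradiction eq (distinct-ends rs)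
    corners-injective 3F 0F eq = contradiction eq (distinct-ends sp)
    corners-injective 3F 1F eq = contradiction (sym eq) q≢s
    corners-injective 3F 2F eq = contradiction (sym eq) (distinct-ends rs)
    corners-injective 3F 3F _  = refl

  CyclesSumTo34 : (Vertex G → ℕ) → Set
  CyclesSumTo34 f = ∀ (c : FourCycle G) → ∑ (f ∘ vertex c) ≡ 34

mapCycle : ∀ {G H} → GraphIso G H → FourCycle G → FourCycle H
mapCycle φ c = record
  { vertex   = GraphIso.to φ ∘ vertex c
  ; distinct = distinct c ∘ to-injective (GraphIso.bijection φ)
  ; adjacent = λ i → GraphIso.preserves φ (adjacent c i)
  }

Q₄⇒FQ₄-cycle : FourCycle Q₄ → FourCycle FQ₄
Q₄⇒FQ₄-cycle c = record
  { vertex   = vertex c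
  ; distinct = distinct c
  ; adjacent = λ i → inj₁ (adjacent c i)
  }

square : (V → ℕ) → V → Fin 5 → Fin 5 → ℕ
square f v i j = ∑ (f ∘ corners v (v ▸ i) (v ▸ i ▸ j) (v ▸ j))

Balanced : (V → ℕ) → Set
Balanced f = ∀ v {i j} → i ≢ j → square f v i j ≡ 34

-- By `rectangle` the opposite edges of a 4-cycle are parallel, so the cycle is a `square`;
-- distinctness of its vertices excludes the degenerate walks.
balanced⇒cycles : ∀ f → Balanced f → CyclesSumTo34 FQ₄ f
balanced⇒cycles f balanced c
  with a , v₁≡ ← FQ₄-adj⇒▸ {vertex c 0F} {vertex c 1F} (adjacent c 0F)
  with b , v₂≡ ← FQ₄-adj⇒▸ {vertex c 1F} {vertex c 2F} (adjacent c 1F)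
  with d , v₂≡′ ← FQ₄-adj⇒▸ {vertex c 3F} {vertex c 2F}
    (symm FQ₄ {vertex c 2F} {vertex c 3F} (adjacent c 2F))
  with c′ , v₃≡ ← FQ₄-adj⇒▸ {vertex c 0F} {vertex c 3F}
    (symm FQ₄ {vertex c 3F} {vertex c 0F} (adjacent c 3F))
  with rectangle (vertex c 0F)
    (trans (sym (trans v₂≡ (cong (_▸ b) v₁≡))) (trans v₂≡′ (cong (_▸ d) v₃≡)))
    (λ { refl → contradiction (distinct c {1F} {3F} (trans v₁≡ (sym v₃≡))) λ () })
... | inj₁ refl = contradiction
  (distinct c {0F} {2F}
    (sym (trans v₂≡ (trans (cong (_▸ b) v₁≡) (▸-involutive _ b))))) λ ()
... | inj₂ (_ , refl) = trans
  (cong₂ (λ q x → f (vertex c 0F) + (f q + x)) v₁≡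
    (cong₂ (λ r s → f r + (f s + 0)) (trans v₂≡ (cong (_▸ b) v₁≡)) v₃≡))
  (balanced (vertex c 0F) {a} {b} λ { refl →
    contradiction (distinct c {1F} {3F} (trans v₁≡ (sym v₃≡))) λ () })

squareCycle : ∀ v {i j : Fin 4} → i ≢ j → FourCycle Q₄
squareCycle v {i} {j} i≢j = fourCycle Q₄
  {v} {v ▸ suc i} {v ▸ suc i ▸ suc j} {v ▸ suc j}
  (▸⇒Q₄-adj v i) (▸⇒Q₄-adj (v ▸ suc i) j)
  (subst (λ u → Adj Q₄ u (v ▸ suc j)) (▸-comm v (suc j) (suc i))
    (symm Q₄ {v ▸ suc j} {v ▸ suc j ▸ suc i} (▸⇒Q₄-adj (v ▸ suc j) i)))
  (symm Q₄ {v} {v ▸ suc j} (▸⇒Q₄-adj v j))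
  (λ v≡ → suc-i≢suc-j (▸-injective v (▸-cancel (suc j)
    (trans (sym v≡) (sym (▸-involutive v (suc j)))))))
  (suc-i≢suc-j ∘ ▸-injective v)
  where
  suc-i≢suc-j : suc i ≢ suc j
  suc-i≢suc-j = i≢j ∘ Fin.suc-injective

-- The labels rearrange 1, ..., 16, whose sum is 136 = 4 · 34.
label-total : ∀ (L : V ↔ Fin 16) → sumᶠ (label L ∘ Inverse.from (Vec-Bool↔Fin 4)) ≡ 136
label-total L = sym (sum-permute (suc ∘ toℕ) (L ↔-∘ ↔-sym (Vec-Bool↔Fin 4)))

opaque
  unfolding _▸_ _⊕_

  -- The sixteen vertices split into four parallel faces.
  face-sum≡34 : ∀ (L : V ↔ Fin 16) {S} → (∀ v → square (label L) v 3F 4F ≡ S) → S ≡ 34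
  face-sum≡34 L {S} face = ℕ.*-cancelˡ-≡ S 34 4 (trans (sym (
    peel false false (peel false true (peel true false (peel true true refl)))))
    (label-total L))
    where
    f : V → ℕ
    f = label L

    face′ : ∀ x y →
      f (x ∷ y ∷ false ∷ false ∷ []) + (f (x ∷ y ∷ true ∷ false ∷ []) +
        (f (x ∷ y ∷ true ∷ true ∷ []) + (f (x ∷ y ∷ false ∷ true ∷ []) + 0))) ≡ S
    face′ false false = face (false ∷ false ∷ false ∷ false ∷ [])
    face′ false true  = face (false ∷ true  ∷ false ∷ false ∷ [])
    face′ true  false = face (true  ∷ false ∷ false ∷ false ∷ [])
    face′ true  true  = face (true  ∷ true  ∷ false ∷ false ∷ [])

    reorder : ∀ a b c d r → a + (b + (c + (d + r))) ≡ (a + (c + (d + (b + 0)))) + r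
    reorder = solve-∀

    -- The total lists the vertices lexicographically, so each four consecutive terms form one face,
    -- up to the cyclic order used by `square`.
    peel : ∀ x y {r s} → r ≡ s →
      f (x ∷ y ∷ false ∷ false ∷ []) + (f (x ∷ y ∷ false ∷ true ∷ []) +
        (f (x ∷ y ∷ true ∷ false ∷ []) + (f (x ∷ y ∷ true ∷ true ∷ []) + r))) ≡ S + s
    peel x y {r} refl = trans
      (reorder (f (x ∷ y ∷ false ∷ false ∷ [])) (f (x ∷ y ∷ false ∷ true ∷ []))
        (f (x ∷ y ∷ true ∷ false ∷ [])) (f (x ∷ y ∷ true ∷ true ∷ [])) r)
      (cong (_+ r) (face′ x y))

opaque
  unfolding _▸_ _⊕_

  -- The five directions sum to zero.
  complement : ∀ (i : Fin 4) → ∃ λ j → ∃ λ k → ∃ λ l → i ≢ j × i ≢ k × i ≢ l ×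
               (∀ v → v ▸ suc j ▸ suc k ▸ suc l ≡ v ▸ 0F ▸ suc i)
  complement = λ
    { 0F → 1F , 2F , 3F , (λ ()) , (λ ()) , (λ ()) , λ v → sum-of 2F 3F 4F 1F v refl
    ; 1F → 0F , 2F , 3F , (λ ()) , (λ ()) , (λ ()) , λ v → sum-of 1F 3F 4F 2F v refl
    ; 2F → 0F , 1F , 3F , (λ ()) , (λ ()) , (λ ()) , λ v → sum-of 1F 2F 4F 3F v refl
    ; 3F → 0F , 1F , 2F , (λ ()) , (λ ()) , (λ ()) , λ v → sum-of 1F 2F 3F 4F v refl
    }
    where
    sum-of : ∀ j k l i v → δ j ⊕ δ k ⊕ δ l ≡ δ 0F ⊕ δ i →
             v ▸ j ▸ k ▸ l ≡ v ▸ 0F ▸ i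
    sum-of j k l i v eq = begin
      v ▸ j ▸ k ▸ l             ≡⟨ cong (_▸ l) (⊕-assoc v (δ j) (δ k)) ⟩
      v ⊕ (δ j ⊕ δ k) ▸ l       ≡⟨ ⊕-assoc v (δ j ⊕ δ k) (δ l) ⟩
      v ⊕ (δ j ⊕ δ k ⊕ δ l)     ≡⟨ cong (v ⊕_) eq ⟩
      v ⊕ (δ 0F ⊕ δ i)          ≡⟨ ⊕-assoc v (δ 0F) (δ i) ⟨
      v ▸ 0F ▸ i                ∎
      where open ≡-Reasoning

-- In terms of the edge sums D v = f v + f (v ▸ i), a square says that D v and
-- D (v ▸ j) add up to 34, so D alternates along a path avoiding direction i.
faces⇒balanced : ∀ f →
  (∀ v {i j : Fin 4} → i ≢ j → square f v (suc i) (suc j) ≡ 34) → Balanced f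
faces⇒balanced f faces = balanced
  where
  swap-square : ∀ a b c d → a + (b + (c + (d + 0))) ≡ a + (d + (c + (b + 0)))
  swap-square = solve-∀

  pair-up : ∀ a b c d → a + (b + (c + (d + 0))) ≡ (a + b) + (d + c)
  pair-up = solve-∀

  pair-up′ : ∀ a b c d → a + (b + (c + (d + 0))) ≡ (a + b) + (c + d)
  pair-up′ = solve-∀

  D : Fin 4 → V → ℕ
  D i v = f v + f (v ▸ suc i)

  alternates : ∀ {i j} v → i ≢ j → D i v + D i (v ▸ suc j) ≡ 34
  alternates {i} {j} v i≢j = trans
    (cong (λ u → D i v + (f (v ▸ suc j) + f u)) (▸-comm v (suc j) (suc i)))
    (trans (sym (pair-up (f v) (f (v ▸ suc i)) (f (v ▸ suc i ▸ suc j)) (f (v ▸ suc j))))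
      (faces v i≢j))

  antipodal : ∀ v i → square f v (suc i) 0F ≡ 34
  antipodal v i = let j , k , l , i≢j , i≢k , i≢l , path = complement i in begin
    square f v (suc i) 0F
      ≡⟨ pair-up′ (f v) (f (v ▸ suc i)) (f (v ▸ suc i ▸ 0F)) (f (v ▸ 0F)) ⟩
    D i v + (f (v ▸ suc i ▸ 0F) + f (v ▸ 0F))
      -- The path ends at `v ▸ 0F ▸ suc i`, and the edge there in direction `suc i` is the side of
      -- the square opposite to the one counted by `D i v`.
      ≡⟨ cong (D i v +_) (cong₂ (λ u w → f u + f w)
           (trans (▸-comm v (suc i) 0F) (sym (path v)))
           (trans (sym (▸-involutive (v ▸ 0F) (suc i))) (cong (_▸ suc i) (sym (path v))))) ⟩
    D i v + D i (v ▸ suc j ▸ suc k ▸ suc l)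
      ≡⟨ cong (_+ D i (v ▸ suc j ▸ suc k ▸ suc l))
           (two-steps-equal {D i v} {D i (v ▸ suc j)} {D i (v ▸ suc j ▸ suc k)}
             (alternates v i≢j) (alternates (v ▸ suc j) i≢k)) ⟩
    D i (v ▸ suc j ▸ suc k) + D i (v ▸ suc j ▸ suc k ▸ suc l)
      ≡⟨ alternates (v ▸ suc j ▸ suc k) i≢l ⟩
    34 ∎
    where
    open ≡-Reasoning
    two-steps-equal : ∀ {a b c s} → a + b ≡ s → b + c ≡ s → a ≡ c
    two-steps-equal {a} {b} {c} refl b+c≡ =
      ℕ.+-cancelˡ-≡ b a c (trans (ℕ.+-comm b a) (sym b+c≡))

  balanced : Balanced f
  balanced v {zero}  {zero}  0≢0 = contradiction refl 0≢0
  balanced v {suc i} {zero}  _   = antipodal v i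
  balanced v {zero}  {suc j} _   = trans
    (trans (swap-square (f v) (f (v ▸ 0F)) (f (v ▸ 0F ▸ suc j)) (f (v ▸ suc j)))
      (cong (λ u → f v + (f (v ▸ suc j) + (f u + (f (v ▸ 0F) + 0)))) (▸-comm v 0F (suc j))))
    (antipodal v j)
  balanced v {suc i} {suc j} i≢j = faces v (i≢j ∘ cong suc)

-- `MagicFaced` names no common sum; a reference face supplies it, and `face-sum≡34` evaluates it.
magicFaced⇒balanced : ∀ L → MagicFaced L → Balanced (label L)
magicFaced⇒balanced L magic = faces⇒balanced (label L) λ v i≢j →
  trans (magic (squareCycle v i≢j) reference)
    (face-sum≡34 L λ u → magic (squareCycle u 2≢3) reference)
  where
  2≢3 : 2F ≢ 3F
  2≢3 ()

  reference : FourCycle Q₄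
  reference = squareCycle 𝟘 2≢3

magicFaced⇒cycles : ∀ L → MagicFaced L → CyclesSumTo34 FQ₄ (label L)
magicFaced⇒cycles L magic = balanced⇒cycles (label L) (magicFaced⇒balanced L magic)

cycles⇒magicFaced : ∀ L → CyclesSumTo34 FQ₄ (label L) → MagicFaced L
cycles⇒magicFaced L cycles c d =
  trans (cycles (Q₄⇒FQ₄-cycle c)) (sym (cycles (Q₄⇒FQ₄-cycle d)))

-- The condition is first extended to all 4-cycles of FQ₄, which automorphisms of FQ₄ permute; the
-- sum of `g · L` over `c` is that of `L` over the preimage of `c`.
magicFaced-stable : Stable actionOnLabellings MagicFaced
magicFaced-stable g {L} magic = cycles⇒magicFaced (LeftAction._·_ actionOnLabellings g L)
  λ c → magicFaced⇒cycles L magic (mapCycle (Group._⁻¹ (Aut FQ₄) g) c)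

-- Labels around the vertex with the largest label

-- The 1 + 5 + 10 vertices by distance from `x`. Those at distance two are written with three
-- directions, the complement of the two, because `value-three` needs that form.
data Near (x : V) : V → Set where
  centre : Near x x
  one    : ∀ k → Near x (x ▸ k)
  three  : ∀ {p q r} → p ≢ q → q ≢ r → p ≢ r → Near x (x ▸ p ▸ q ▸ r)

opaque
  unfolding _▸_ _⊕_

  near-𝟘 : ∀ v → Near 𝟘 v
  near-𝟘 (false ∷ false ∷ false ∷ false ∷ []) = centre
  near-𝟘 (true  ∷ false ∷ false ∷ false ∷ []) = one 1F
  near-𝟘 (false ∷ true  ∷ false ∷ false ∷ []) = one 2F
  near-𝟘 (false ∷ false ∷ true  ∷ false ∷ []) = one 3F
  near-𝟘 (false ∷ false ∷ false ∷ true  ∷ []) = one 4F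
  near-𝟘 (true  ∷ true  ∷ true  ∷ true  ∷ []) = one 0F
  near-𝟘 (true  ∷ true  ∷ true  ∷ false ∷ []) = three {p = 1F} {2F} {3F} (λ ()) (λ ()) (λ ())
  near-𝟘 (true  ∷ true  ∷ false ∷ true  ∷ []) = three {p = 1F} {2F} {4F} (λ ()) (λ ()) (λ ())
  near-𝟘 (true  ∷ false ∷ true  ∷ true  ∷ []) = three {p = 1F} {3F} {4F} (λ ()) (λ ()) (λ ())
  near-𝟘 (false ∷ true  ∷ true  ∷ true  ∷ []) = three {p = 2F} {3F} {4F} (λ ()) (λ ()) (λ ())
  near-𝟘 (true  ∷ true  ∷ false ∷ false ∷ []) = three {p = 0F} {3F} {4F} (λ ()) (λ ()) (λ ())
  near-𝟘 (true  ∷ false ∷ true  ∷ false ∷ []) = three {p = 0F} {2F} {4F} (λ ()) (λ ()) (λ ())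
  near-𝟘 (true  ∷ false ∷ false ∷ true  ∷ []) = three {p = 0F} {2F} {3F} (λ ()) (λ ()) (λ ())
  near-𝟘 (false ∷ true  ∷ true  ∷ false ∷ []) = three {p = 0F} {1F} {4F} (λ ()) (λ ()) (λ ())
  near-𝟘 (false ∷ true  ∷ false ∷ true  ∷ []) = three {p = 0F} {1F} {3F} (λ ()) (λ ()) (λ ())
  near-𝟘 (false ∷ false ∷ true  ∷ true  ∷ []) = three {p = 0F} {1F} {2F} (λ ()) (λ ()) (λ ())

near : ∀ x v → Near x v
near x v = subst (Near x) (⊕-cancelˡ x v) (translate (near-𝟘 (x ⊕ v)))
  where
  translate : ∀ {w} → Near 𝟘 w → Near x (x ⊕ w)
  translate centre  = subst (Near x) (sym (⊕-identityʳ x)) centre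
  translate (one k) = subst (Near x)
    (sym (trans (⊕-▸ x 𝟘 k) (cong (_▸ k) (⊕-identityʳ x)))) (one k)
  translate (three {p} {q} {r} p≢q q≢r p≢r) = subst (Near x)
    (sym (trans (⊕-▸ x (𝟘 ▸ p ▸ q) r) (cong (_▸ r)
      (trans (⊕-▸ x (𝟘 ▸ p) q) (cong (_▸ q)
        (trans (⊕-▸ x 𝟘 p) (cong (_▸ p) (⊕-identityʳ x))))))))
    (three p≢q q≢r p≢r)

-- Moving `r` across gives `x ▸ p ▸ q ≡ x ▸ k ▸ r`, to which `rectangle` applies unless `p ≡ k`.
three≢one : ∀ x {p q r k} → p ≢ q → q ≢ r → p ≢ r → x ▸ p ▸ q ▸ r ≢ x ▸ k
three≢one x {p} {q} {r} {k} p≢q q≢r p≢r eq with p ≟ k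
... | yes refl = q≢r (▸-injective (x ▸ p ▸ q)
  (trans (▸-involutive (x ▸ p) q) (sym eq)))
... | no p≢k with rectangle x
  (trans (▸-cancel r (trans eq (sym (▸-involutive (x ▸ k) r)))) refl) p≢k
...   | inj₁ p≡q       = p≢q p≡q
...   | inj₂ (p≡r , _) = p≢r p≡r

-- The label minus one.
value : V ↔ Fin 16 → V → ℕ
value L v = toℕ (Inverse.to L v)

value-injective : ∀ L {u v} → value L u ≡ value L v → u ≡ v
value-injective L = to-injective L ∘ Fin.toℕ-injective

-- The sum of the first two equations minus the third; everything but `t` and `a + b + c` cancels
-- because the common total is twice `n`.
eliminate : ∀ n a b c s t u → n + (a + (s + b)) ≡ n + n → n + (a + (u + c)) ≡ n + n →
            a + (s + (t + u)) ≡ n + n → t ≡ a + b + c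
eliminate n a b c s t u eq₁ eq₂ eq₃ =
  ℕ.+-cancelʳ-≡ (a + s + u) t (a + b + c) (ℕ.+-cancelˡ-≡ (n + n) _ _ (begin
    n + n + (t + (a + s + u))              ≡⟨ rearrange₁ (n + n) a s t u ⟨
    n + n + (a + (s + (t + u)))            ≡⟨ cong (n + n +_) eq₃ ⟩
    n + n + (n + n)                        ≡⟨ cong₂ _+_ eq₁ eq₂ ⟨
    n + (a + (s + b)) + (n + (a + (u + c))) ≡⟨ rearrange₂ n a b c s u ⟩
    n + n + ((a + b + c) + (a + s + u))    ∎))
  where
  open ≡-Reasoning

  rearrange₁ : ∀ m a s t u → m + (a + (s + (t + u))) ≡ m + (t + (a + s + u))
  rearrange₁ = solve-∀

  rearrange₂ : ∀ n a b c s u → n + (a + (s + b)) + (n + (a + (u + c)))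
                             ≡ n + n + ((a + b + c) + (a + s + u))
  rearrange₂ = solve-∀

power : Fin 5 → ℕ
power = lookup (0 ∷ 8 ∷ 4 ∷ 2 ∷ 1 ∷ [])

-- `ns` holds the values already known not to be next to `x`. The bounds hold for all summands of
-- `m` and make the condition a finite check.
Unsplittable : List ℕ → ℕ → Set
Unsplittable ns m = ∀ {a} → a ℕ.< suc m → ∀ {b} → b ℕ.< suc m → ∀ {c} → c ℕ.< suc m →
  a + b + c ≡ m → a ≢ b → b ≢ c → a ≢ c → a ∈ˡ ns ⊎ b ∈ˡ ns ⊎ c ∈ˡ ns

unsplittable? : ∀ ns m → Dec (Unsplittable ns m)
unsplittable? ns m =
  ℕ.allUpTo? (λ a → ℕ.allUpTo? (λ b → ℕ.allUpTo? (λ c →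
    (a + b + c ℕ.≟ m) →-dec (¬? (a ℕ.≟ b) →-dec (¬? (b ℕ.≟ c) →-dec (¬? (a ℕ.≟ c) →-dec
      ((a ∈? ns) ⊎-dec ((b ∈? ns) ⊎-dec (c ∈? ns)))))))
    (suc m)) (suc m)) (suc m)

module _ (L : V ↔ Fin 16) (balanced : Balanced (label L))
         (x : V) (value-x : value L x ≡ 15) where

  square-values : ∀ v {i j} → i ≢ j →
    value L v + (value L (v ▸ i) + (value L (v ▸ i ▸ j) + value L (v ▸ j))) ≡ 30
  square-values v {i} {j} i≢j = ℕ.+-cancelʳ-≡ 4 _ 30
    (trans (shift (value L v) (value L (v ▸ i)) (value L (v ▸ i ▸ j)) (value L (v ▸ j)))
      (balanced v i≢j))
    where
    shift : ∀ a b c d → a + (b + (c + d)) + 4 ≡ suc a + (suc b + (suc c + (suc d + 0)))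
    shift = solve-∀

  -- Combines the squares at `x` in directions `p`, `q` and `p`, `r` with the square at `x ▸ p` in
  -- directions `q`, `r`.
  value-three : ∀ {p q r} → p ≢ q → q ≢ r → p ≢ r →
    value L (x ▸ p ▸ q ▸ r) ≡ value L (x ▸ p) + value L (x ▸ q) + value L (x ▸ r)
  value-three {p} {q} {r} p≢q q≢r p≢r = eliminate 15
    (value L (x ▸ p)) (value L (x ▸ q)) (value L (x ▸ r)) (value L (x ▸ p ▸ q))
    (value L (x ▸ p ▸ q ▸ r)) (value L (x ▸ p ▸ r))
    (square-at-x p≢q) (square-at-x p≢r) (square-values (x ▸ p) q≢r)
    where
    square-at-x : ∀ {i j} → i ≢ j →
      15 + (value L (x ▸ i) + (value L (x ▸ i ▸ j) + value L (x ▸ j))) ≡ 30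
    square-at-x {i} {j} i≢j = subst
      (λ n → n + (value L (x ▸ i) + (value L (x ▸ i ▸ j) + value L (x ▸ j))) ≡ 30)
      value-x (square-values x i≢j)

  Single : ℕ → Set
  Single m = ∃ λ k → value L (x ▸ k) ≡ m

  unsplittable-three : ∀ {ns m p q r} → Unsplittable ns m → p ≢ q → q ≢ r → p ≢ r →
                       value L (x ▸ p ▸ q ▸ r) ≡ m → ∃ λ n → n ∈ˡ ns × Single n
  unsplittable-three {ns} {p = p} {q} {r} unsplittable p≢q q≢r p≢r refl =
    summand (unsplittable
      (bound (ℕ.≤-trans (ℕ.m≤m+n a b) (ℕ.m≤m+n (a + b) c)))
      (bound (ℕ.≤-trans (ℕ.m≤n+m b a) (ℕ.m≤m+n (a + b) c)))
      (bound (ℕ.m≤n+m c (a + b)))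
      (sym (value-three p≢q q≢r p≢r))
      (values-differ p≢q) (values-differ q≢r) (values-differ p≢r))
    where
    a b c : ℕ
    a = value L (x ▸ p)
    b = value L (x ▸ q)
    c = value L (x ▸ r)

    bound : ∀ {n} → n ℕ.≤ a + b + c → n ℕ.< suc (value L (x ▸ p ▸ q ▸ r))
    bound {n} n≤ = ℕ.s≤s (subst (n ℕ.≤_) (sym (value-three p≢q q≢r p≢r)) n≤)

    values-differ : ∀ {i j} → i ≢ j → value L (x ▸ i) ≢ value L (x ▸ j)
    values-differ i≢j = i≢j ∘ ▸-injective x ∘ value-injective L

    summand : a ∈ˡ ns ⊎ b ∈ˡ ns ⊎ c ∈ˡ ns → ∃ λ n → n ∈ˡ ns × Single n
    summand (inj₁ a∈ns)        = a , a∈ns , p , refl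
    summand (inj₂ (inj₁ b∈ns)) = b , b∈ns , q , refl
    summand (inj₂ (inj₂ c∈ns)) = c , c∈ns , r , refl

  -- The vertex of value `m` is not `x`, and at distance two it would make `m` a sum of three
  -- distinct neighbouring values, one of them in `ns`.
  single : ∀ {m} ns → Unsplittable ns m → m ≢ 15 → m ℕ.< 16 →
           (∀ {n} → n ∈ˡ ns → ¬ Single n) → Single m
  single {m} ns unsplittable m≢15 m<16 ns-not-single = locate
    (near x (Inverse.from L (fromℕ< m<16)))
    (trans (cong toℕ (Inverse.strictlyInverseˡ L (fromℕ< m<16))) (Fin.toℕ-fromℕ< m<16))
    where
    locate : ∀ {v} → Near x v → value L v ≡ m → Single m
    locate centre  eq = contradiction (trans (sym eq) value-x) m≢15
    locate (one k) eq = k , eq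
    locate (three p≢q q≢r p≢r) eq =
      let n , n∈ns , n-single = unsplittable-three unsplittable p≢q q≢r p≢r eq
      in  contradiction n-single (ns-not-single n∈ns)

  -- The value `a + b + c` is already taken by a vertex at distance two.
  sum-not-single : ∀ {a b c} → Single a → Single b → Single c →
                   a ≢ b → b ≢ c → a ≢ c → ¬ Single (a + b + c)
  sum-not-single (p , refl) (q , refl) (r , refl) a≢b b≢c a≢c (k , eq) =
    three≢one x p≢q q≢r p≢r (value-injective L (trans (value-three p≢q q≢r p≢r) (sym eq)))
    where
    p≢q : p ≢ q
    p≢q refl = a≢b refl
    q≢r : q ≢ r
    q≢r refl = b≢c refl
    p≢r : p ≢ r
    p≢r refl = a≢c refl

  -- 0, 1 and 2 are below 0 + 1 + 2. The only splitting of 4 is 0 + 1 + 3, and 3 = 0 + 1 + 2 is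
  -- excluded. Every splitting of 8 uses 3, 5, 6 or 7, each a sum of three among 0, 1, 2, 4.
  power-single : ∀ k → Single (power k)
  power-single = λ
    { 0F → single-0 ; 1F → single-8 ; 2F → single-4 ; 3F → single-2 ; 4F → single-1 }
    where
    single-0 : Single 0
    single-0 = single [] (from-yes (unsplittable? [] 0)) (λ ()) (from-yes (0 ℕ.<? 16)) λ ()

    single-1 : Single 1
    single-1 = single [] (from-yes (unsplittable? [] 1)) (λ ()) (from-yes (1 ℕ.<? 16)) λ ()

    single-2 : Single 2
    single-2 = single [] (from-yes (unsplittable? [] 2)) (λ ()) (from-yes (2 ℕ.<? 16)) λ ()

    single-4 : Single 4
    single-4 = single (3 ∷ []) (from-yes (unsplittable? (3 ∷ []) 4)) (λ ())
      (from-yes (4 ℕ.<? 16)) λ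
      { (here refl) → sum-not-single single-0 single-1 single-2 (λ ()) (λ ()) (λ ()) }

    single-8 : Single 8
    single-8 = single (3 ∷ 5 ∷ 6 ∷ 7 ∷ []) (from-yes (unsplittable? (3 ∷ 5 ∷ 6 ∷ 7 ∷ []) 8))
      (λ ()) (from-yes (8 ℕ.<? 16)) λ
      { (here refl) →
          sum-not-single single-0 single-1 single-2 (λ ()) (λ ()) (λ ())
      ; (there (here refl)) →
          sum-not-single single-0 single-1 single-4 (λ ()) (λ ()) (λ ())
      ; (there (there (here refl))) →
          sum-not-single single-0 single-2 single-4 (λ ()) (λ ()) (λ ())
      ; (there (there (there (here refl)))) →
          sum-not-single single-1 single-2 single-4 (λ ()) (λ ()) (λ ())
      }

-- The standard labelling

∀V? : ∀ {p} {P : V → Set p} → (∀ v → Dec (P v)) → Dec (∀ v → P v)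
∀V? {P = P} P? = map′
  (λ all v → subst P (strictlyInverseʳ v) (all (to v)))
  (λ all k → all (from k))
  (all? λ k → P? (from k))
  where open Inverse (Vec-Bool↔Fin 4) using (to; from; strictlyInverseʳ)

-- Composed with binary notation, twist gives 𝟘 the value 15 and its neighbours
-- the values 0, 8, 4, 2, 1.
twist : V → V
twist (a ∷ b ∷ c ∷ d ∷ []) =
  not (b xor c xor d) ∷ not (a xor c xor d) ∷ not (a xor b xor d) ∷ not (a xor b xor c) ∷ []

L₀ : V ↔ Fin 16
L₀ = Vec-Bool↔Fin 4 ↔-∘ mk↔ₛ′ twist twist twist-involutive twist-involutive
  where
  twist-involutive : ∀ v → twist (twist v) ≡ v
  twist-involutive = from-yes (∀V? λ v → twist (twist v) ≟ⱽ v)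

opaque
  unfolding _▸_ _⊕_

  L₀-balanced : Balanced (label L₀)
  L₀-balanced v {i} {j} = table v i j
    where
    table : ∀ v i j → i ≢ j → square (label L₀) v i j ≡ 34
    table = from-yes (∀V? λ v → all? λ i → all? λ j →
      ¬? (i ≟ j) →-dec (square (label L₀) v i j ℕ.≟ 34))

  value-L₀-neighbour : ∀ k → value L₀ (𝟘 ▸ k) ≡ power k
  value-L₀-neighbour = from-yes (all? λ k → value L₀ (𝟘 ▸ k) ℕ.≟ power k)

L₀-magic : MagicFaced L₀
L₀-magic = cycles⇒magicFaced L₀ (balanced⇒cycles (label L₀) L₀-balanced)

-- The affine map takes `𝟘` to the vertex of value 15 and direction `k` to the direction of value
-- `power k`. Both labellings obey `value-three`, so agreement on the neighbours extends to all
-- vertices.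
standard-form : ∀ L → MagicFaced L →
  ∃ λ (g : GraphIso FQ₄ FQ₄) → ∀ v → Inverse.to L (GraphIso.to g v) ≡ Inverse.to L₀ v
standard-form L magic = affineAut x σ , λ v → Fin.toℕ-injective (agree (near 𝟘 v))
  where
  x : V
  x = Inverse.from L (fromℕ 15)

  value-x : value L x ≡ 15
  value-x = cong toℕ (Inverse.strictlyInverseˡ L (fromℕ 15))

  balanced : Balanced (label L)
  balanced = magicFaced⇒balanced L magic

  neighbour : ∀ k → ∃ λ i → value L (x ▸ i) ≡ power k
  neighbour = power-single L balanced x value-x

  power-injective : ∀ i j → power i ≡ power j → i ≡ j
  power-injective = from-yes (all? λ i → all? λ j → (power i ℕ.≟ power j) →-dec (i ≟ j))

  direction-injective : Injective _≡_ _≡_ (proj₁ ∘ neighbour)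
  direction-injective {i} {j} eq = power-injective i j (trans (sym (proj₂ (neighbour i)))
    (trans (cong (λ k → value L (x ▸ k)) eq) (proj₂ (neighbour j))))

  σ : Fin 5 ↔ Fin 5
  σ = injective⇒↔ direction-injective

  g : V → V
  g = Inverse.to (affine x σ)

  g-▸ : ∀ v k → g (v ▸ k) ≡ g v ▸ Inverse.to σ k
  g-▸ = equivariant (affine-along x σ)

  g-𝟘▸ : ∀ k → g (𝟘 ▸ k) ≡ x ▸ Inverse.to σ k
  g-𝟘▸ k = trans (g-▸ 𝟘 k) (cong (_▸ Inverse.to σ k) (affine-𝟘 x σ))

  agree-one : ∀ k → value L (x ▸ Inverse.to σ k) ≡ value L₀ (𝟘 ▸ k)
  agree-one k = trans (proj₂ (neighbour k)) (sym (value-L₀-neighbour k))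

  agree : ∀ {v} → Near 𝟘 v → value L (g v) ≡ value L₀ v
  agree centre  = trans (cong (value L) (affine-𝟘 x σ)) value-x
  agree (one k) = trans (cong (value L) (g-𝟘▸ k)) (agree-one k)
  agree (three {p} {q} {r} p≢q q≢r p≢r) = begin
    value L (g (𝟘 ▸ p ▸ q ▸ r))
      ≡⟨ cong (value L) (trans (g-▸ (𝟘 ▸ p ▸ q) r) (cong (_▸ σ.to r)
           (trans (g-▸ (𝟘 ▸ p) q) (cong (_▸ σ.to q) (g-𝟘▸ p))))) ⟩
    value L (x ▸ σ.to p ▸ σ.to q ▸ σ.to r)
      ≡⟨ value-three L balanced x value-x
           (p≢q ∘ to-injective σ) (q≢r ∘ to-injective σ) (p≢r ∘ to-injective σ) ⟩
    value L (x ▸ σ.to p) + value L (x ▸ σ.to q) + value L (x ▸ σ.to r)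
      ≡⟨ cong₂ _+_ (cong₂ _+_ (agree-one p) (agree-one q)) (agree-one r) ⟩
    value L₀ (𝟘 ▸ p) + value L₀ (𝟘 ▸ q) + value L₀ (𝟘 ▸ r)
      ≡⟨ value-three L₀ L₀-balanced 𝟘 refl p≢q q≢r p≢r ⟨
    value L₀ (𝟘 ▸ p ▸ q ▸ r) ∎
    where
    open ≡-Reasoning
    module σ = Inverse σ

-- Simple transitivity and the number of tesseracts

open LeftAction actionOnLabellings using (_·_)

labellings-free : ∀ (g h : GraphIso FQ₄ FQ₄) (L : V ↔ Fin 16) →
  (∀ v → Inverse.to (g · L) v ≡ Inverse.to (h · L) v) → g ≈ᴬ h
labellings-free g h L gL≈hL = from-cong
  (↔-sym (GraphIso.bijection g)) (↔-sym (GraphIso.bijection h))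
  λ v → to-injective L (gL≈hL v)

-- Both labellings pull back to `L₀`, one along `g` and the other along `h`, so h g⁻¹ carries `L` to
-- `M`.
carry : ∀ L M → MagicFaced L → MagicFaced M →
  ∃ λ g → ∀ v → Inverse.to (g · L) v ≡ Inverse.to M v
carry L M L-magic M-magic =
  let g , Lg≗L₀ = standard-form L L-magic
      h , Mh≗L₀ = standard-form M M-magic
      module h = Inverse (GraphIso.bijection h)
  in  h ∙ᴬ Group._⁻¹ (Aut FQ₄) g , λ v →
        trans (Lg≗L₀ (h.from v))
          (trans (sym (Mh≗L₀ (h.from v))) (cong (Inverse.to M) (h.strictlyInverseˡ v)))

labellings-faithful-transitive : ActsFaithfullyTransitivelyOn actionOnLabellings MagicFaced
labellings-faithful-transitive =
  (λ g {L} → magicFaced-stable g {L}) ,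
  (λ g fixes → labellings-free g (Group.ε (Aut FQ₄)) L₀ (fixes (L₀ , L₀-magic))) ,
  (λ (L , L-magic) (M , M-magic) → carry L M L-magic M-magic)

∣MagicFacedTesseract∣≡1920 : HasCardinality MagicFacedTesseract 1920
∣MagicFacedTesseract∣≡1920 = Composition.inverse {S = Group.setoid (Aut FQ₄)}
  (Symmetry.inverse (Bijection⇒Inverse (record
    { to        = orbit
    ; cong      = λ {g} {h} → orbit-cong {g} {h}
    ; bijective =
        (λ {g} {h} → labellings-free g h L₀) ,
        (λ (L , L-magic) →
          let g , gL₀≈L = carry L₀ L L₀-magic L-magic
          in  g , λ {h} h≈g v → trans (orbit-cong {h} {g} h≈g v) (gL₀≈L v))
    })))
  ∣Aut[FQ₄]∣≡1920
  where
  orbit : GraphIso FQ₄ FQ₄ → Setoid.Carrier MagicFacedTesseract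
  orbit g = g · L₀ , magicFaced-stable g {L₀} L₀-magic

  orbit-cong : ∀ {g h} → g ≈ᴬ h → ∀ v → Inverse.to (g · L₀) v ≡ Inverse.to (h · L₀) v
  orbit-cong {g} {h} g≈h =
    LeftAction.·-cong actionOnLabellings {g} {h} {L₀} {L₀} g≈h (λ _ → refl)

-- Magic squares on C₄ □ C₄

-- C₄ is the square Q₂, and the code 00, 10, 11, 01 visits its vertices in cyclic order; two copies
-- give Q₄.
grayCode : GraphIso (C₄ □ C₄) Q₄
grayCode = record
  { bijection = mk↔ₛ′ to from to∘from from∘to
  ; preserves = λ {(i , j)} {(k , l)} → preserves i j k l
  ; reflects  = λ {(i , j)} {(k , l)} → reflects i j k l
  }
  where
  code : Fin 4 → Vec Bool 2
  code 0F = false ∷ false ∷ []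
  code 1F = true  ∷ false ∷ []
  code 2F = true  ∷ true  ∷ []
  code 3F = false ∷ true  ∷ []

  decode : Bool → Bool → Fin 4
  decode false false = 0F
  decode true  false = 1F
  decode true  true  = 2F
  decode false true  = 3F

  to : Position → V
  to (i , j) = code i ++ code j

  from : V → Position
  from (a ∷ b ∷ c ∷ d ∷ []) = decode a b , decode c d

  to∘from : ∀ v → to (from v) ≡ v
  to∘from = from-yes (∀V? λ v → to (from v) ≟ⱽ v)

  from∘to : ∀ p → from (to p) ≡ p
  from∘to (i , j) = table i j
    where
    table : ∀ i j → from (to (i , j)) ≡ (i , j)
    table = from-yes (all? λ i → all? λ j → ×-≡-dec _≟_ _≟_ (from (to (i , j))) (i , j))

  C₄-adjacent? : ∀ i j → Dec (Adj C₄ i j)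
  C₄-adjacent? i j = (j ≟ next i) ⊎-dec (i ≟ next j)

  adjacent? : ∀ p q → Dec (Adj (C₄ □ C₄) p q)
  adjacent? (i , j) (k , l) =
    ((i ≟ k) ×-dec C₄-adjacent? j l) ⊎-dec (C₄-adjacent? i k ×-dec (j ≟ l))

  preserves : ∀ i j k l → Adj (C₄ □ C₄) (i , j) (k , l) → Adj Q₄ (to (i , j)) (to (k , l))
  preserves = from-yes (all? λ i → all? λ j → all? λ k → all? λ l →
    adjacent? (i , j) (k , l) →-dec (hammingDistance (to (i , j)) (to (k , l)) ℕ.≟ 1))

  reflects : ∀ i j k l → Adj Q₄ (to (i , j)) (to (k , l)) → Adj (C₄ □ C₄) (i , j) (k , l)
  reflects = from-yes (all? λ i → all? λ j → all? λ k → all? λ l →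
    (hammingDistance (to (i , j)) (to (k , l)) ℕ.≟ 1) →-dec adjacent? (i , j) (k , l))

-- Four-cycles of the torus

data TorusCycle : (p q r s : Position) → Set where
  row     : ∀ {r c₀ c₁ c₂ c₃} → TorusCycle (r , c₀) (r , c₁) (r , c₂) (r , c₃)
  column  : ∀ {c r₀ r₁ r₂ r₃} → TorusCycle (r₀ , c) (r₁ , c) (r₂ , c) (r₃ , c)
  block   : ∀ {r r′ c c′} → Adj C₄ r r′ → Adj C₄ c c′ →
            TorusCycle (r , c) (r , c′) (r′ , c′) (r′ , c)
  blockᵀ  : ∀ {r r′ c c′} → Adj C₄ r r′ → Adj C₄ c c′ →
            TorusCycle (r , c) (r′ , c) (r′ , c′) (r , c′)

-- Each edge changes either the row or the column. A single change of either kind would have to be a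
-- loop of C₄, and two equal kinds followed cyclically by two of the other make a diagonal collapse.
classify : ∀ {p q r s} →
  Adj (C₄ □ C₄) p q → Adj (C₄ □ C₄) q r → Adj (C₄ □ C₄) r s → Adj (C₄ □ C₄) s p →
  p ≢ r → q ≢ s → TorusCycle p q r s
classify (inj₁ (refl , _)) (inj₁ (refl , _)) (inj₁ (refl , _)) (inj₁ _) _ _ = row
classify (inj₂ (_ , refl)) (inj₂ (_ , refl)) (inj₂ (_ , refl)) (inj₂ _) _ _ = column
classify (inj₁ (refl , c~)) (inj₂ (r~ , refl)) (inj₁ (refl , _)) (inj₂ (_ , refl)) _ _ = block r~ c~
classify (inj₂ (r~ , refl)) (inj₁ (refl , c~)) (inj₂ (_ , refl)) (inj₁ (refl , _)) _ _ = blockᵀ r~ c~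
classify (inj₁ (refl , _)) (inj₁ (refl , _)) (inj₂ (_ , refl)) (inj₂ (_ , refl)) p≢r _ =
  contradiction refl p≢r
classify (inj₂ (_ , refl)) (inj₂ (_ , refl)) (inj₁ (refl , _)) (inj₁ (refl , _)) p≢r _ =
  contradiction refl p≢r
classify (inj₁ (refl , _)) (inj₂ (_ , refl)) (inj₂ (_ , refl)) (inj₁ (refl , _)) _ q≢s =
  contradiction refl q≢s
classify (inj₂ (_ , refl)) (inj₁ (refl , _)) (inj₁ (refl , _)) (inj₂ (_ , refl)) _ q≢s =
  contradiction refl q≢s
classify (inj₁ (refl , _)) (inj₁ (refl , _)) (inj₁ (refl , _)) (inj₂ (r~ , _)) _ _ =
  contradiction r~ (loopless C₄ refl)
classify (inj₁ (refl , _)) (inj₁ (refl , _)) (inj₂ (r~ , _)) (inj₁ (refl , _)) _ _ =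
  contradiction r~ (loopless C₄ refl)
classify (inj₁ (refl , _)) (inj₂ (r~ , _)) (inj₁ (refl , _)) (inj₁ (refl , _)) _ _ =
  contradiction r~ (loopless C₄ refl)
classify (inj₂ (r~ , _)) (inj₁ (refl , _)) (inj₁ (refl , _)) (inj₁ (refl , _)) _ _ =
  contradiction r~ (loopless C₄ refl)
classify (inj₂ (_ , refl)) (inj₂ (_ , refl)) (inj₂ (_ , refl)) (inj₁ (_ , c~)) _ _ =
  contradiction c~ (loopless C₄ refl)
classify (inj₂ (_ , refl)) (inj₂ (_ , refl)) (inj₁ (_ , c~)) (inj₂ (_ , refl)) _ _ =
  contradiction c~ (loopless C₄ refl)
classify (inj₂ (_ , refl)) (inj₁ (_ , c~)) (inj₂ (_ , refl)) (inj₂ (_ , refl)) _ _ =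
  contradiction c~ (loopless C₄ refl)
classify (inj₁ (_ , c~)) (inj₂ (_ , refl)) (inj₂ (_ , refl)) (inj₂ (_ , refl)) _ _ =
  contradiction c~ (loopless C₄ refl)

corners-map : ∀ {A B : Set} (f : A → B) p q r s i →
              corners (f p) (f q) (f r) (f s) i ≡ f (corners p q r s i)
corners-map f p q r s 0F = refl
corners-map f p q r s 1F = refl
corners-map f p q r s 2F = refl
corners-map f p q r s 3F = refl

-- Four distinct indices exhaust `Fin 4`; hence a cycle inside a row or column has that line's sum,
-- in whatever order it is traversed.
∑-corners : ∀ (f : Fin 4 → ℕ) {i j k l} → Injective _≡_ _≡_ (corners i j k l) →
            ∑ (f ∘ corners i j k l) ≡ ∑ f
∑-corners f inj = sym (sum-permute f (injective⇒↔ inj))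

square⇒cycles : ∀ {A} → MagicSquare A → CyclesSumTo34 (C₄ □ C₄) (label A)
square⇒cycles {A} square c = torus-sum
  (classify (adjacent c 0F) (adjacent c 1F) (adjacent c 2F) (adjacent c 3F)
    (λ eq → contradiction (distinct c {0F} {2F} eq) λ ())
    (λ eq → contradiction (distinct c {1F} {3F} eq) λ ()))
  λ {i} {j} eq → distinct c (trans (sym (corners-η i)) (trans eq (corners-η j)))
  where
  module square = MagicSquare square

  corners-η : ∀ i →
    corners (vertex c 0F) (vertex c 1F) (vertex c 2F) (vertex c 3F) i ≡ vertex c i
  corners-η 0F = refl
  corners-η 1F = refl
  corners-η 2F = refl
  corners-η 3F = refl

  f : Position → ℕ
  f = label A

  from-top-left : ∀ a b c d → a + (b + (c + (d + 0))) ≡ a + b + d + c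
  from-top-left = solve-∀

  from-top-right : ∀ a b c d → a + (b + (c + (d + 0))) ≡ b + a + c + d
  from-top-right = solve-∀

  from-bottom-left : ∀ a b c d → a + (b + (c + (d + 0))) ≡ d + c + a + b
  from-bottom-left = solve-∀

  from-bottom-right : ∀ a b c d → a + (b + (c + (d + 0))) ≡ c + d + b + a
  from-bottom-right = solve-∀

  -- The orientations of the two edges decide which corner of the 2 × 2 block the cycle starts from.
  block-sum : ∀ {r r′ c c′} → Adj C₄ r r′ → Adj C₄ c c′ →
              f (r , c) + (f (r , c′) + (f (r′ , c′) + (f (r′ , c) + 0))) ≡ 34
  block-sum {r} {r′} {c} {c′} (inj₁ refl) (inj₁ refl) =
    trans (from-top-left (f (r , c)) (f (r , c′)) (f (r′ , c′)) (f (r′ , c))) (square.block r c)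
  block-sum {r} {r′} {c} {c′} (inj₁ refl) (inj₂ refl) =
    trans (from-top-right (f (r , c)) (f (r , c′)) (f (r′ , c′)) (f (r′ , c))) (square.block r c′)
  block-sum {r} {r′} {c} {c′} (inj₂ refl) (inj₁ refl) =
    trans (from-bottom-left (f (r , c)) (f (r , c′)) (f (r′ , c′)) (f (r′ , c))) (square.block r′ c)
  block-sum {r} {r′} {c} {c′} (inj₂ refl) (inj₂ refl) =
    trans (from-bottom-right (f (r , c)) (f (r , c′)) (f (r′ , c′)) (f (r′ , c))) (square.block r′ c′)

  transpose-sum : ∀ a b c d → a + (b + (c + (d + 0))) ≡ a + (d + (c + (b + 0)))
  transpose-sum = solve-∀

  torus-sum : ∀ {p q r s} → TorusCycle p q r s →
              Injective _≡_ _≡_ (corners p q r s) → ∑ (f ∘ corners p q r s) ≡ 34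
  torus-sum (row {r} {c₀} {c₁} {c₂} {c₃}) inj = trans
    (∑-corners (λ c → f (r , c)) λ {i} {j} eq → inj
      (trans (corners-map (r ,_) c₀ c₁ c₂ c₃ i)
        (trans (cong (r ,_) eq) (sym (corners-map (r ,_) c₀ c₁ c₂ c₃ j)))))
    (square.row r)
  torus-sum (column {c} {r₀} {r₁} {r₂} {r₃}) inj = trans
    (∑-corners (λ r → f (r , c)) λ {i} {j} eq → inj
      (trans (corners-map (_, c) r₀ r₁ r₂ r₃ i)
        (trans (cong (_, c) eq) (sym (corners-map (_, c) r₀ r₁ r₂ r₃ j)))))
    (square.column c)
  torus-sum (block r~ c~) _ = block-sum r~ c~
  torus-sum (blockᵀ {r} {r′} {c} {c′} r~ c~) _ = trans
    (transpose-sum (f (r , c)) (f (r′ , c)) (f (r′ , c′)) (f (r , c′))) (block-sum r~ c~)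

cycles⇒square : ∀ {A} → CyclesSumTo34 (C₄ □ C₄) (label A) → MagicSquare A
cycles⇒square {A} cycles = record
  { row    = λ i → cycles (fourCycle (C₄ □ C₄) {i , 0F} {i , 1F} {i , 2F} {i , 3F}
      (inj₁ (refl , inj₁ refl)) (inj₁ (refl , inj₁ refl))
      (inj₁ (refl , inj₁ refl)) (inj₁ (refl , inj₁ refl)) (λ ()) (λ ()))
  ; column = λ j → cycles (fourCycle (C₄ □ C₄) {0F , j} {1F , j} {2F , j} {3F , j}
      (inj₂ (inj₁ refl , refl)) (inj₂ (inj₁ refl , refl))
      (inj₂ (inj₁ refl , refl)) (inj₂ (inj₁ refl , refl)) (λ ()) (λ ()))
  ; block  = λ i j → trans
      (reorder (label A (i , j)) (label A (i , next j)) (label A (next i , j)) (label A (next i , next j)))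
      (cycles (fourCycle (C₄ □ C₄) {i , j} {i , next j} {next i , next j} {next i , j}
        (inj₁ (refl , inj₁ refl)) (inj₂ (inj₁ refl , refl))
        (inj₁ (refl , inj₂ refl)) (inj₂ (inj₂ refl , refl))
        (i≢next-i i ∘ cong proj₁) (i≢next-i i ∘ cong proj₁)))
  }
  where
  reorder : ∀ a b c d → a + b + c + d ≡ a + (b + (d + (c + 0)))
  reorder = solve-∀

  i≢next-i : ∀ i → i ≢ next i
  i≢next-i i eq = loopless C₄ eq (inj₁ refl)

-- Transport between tesseracts and arrangements

symIso : ∀ {G H} → GraphIso G H → GraphIso H G
symIso {G} {H} φ = record
  { bijection = ↔-sym bijection
  ; preserves = λ {u} {v} uv → reflects
      (≡.subst₂ (Adj H) (sym (φ.strictlyInverseˡ u)) (sym (φ.strictlyInverseˡ v)) uv)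
  ; reflects  = λ {u} {v} uv →
      ≡.subst₂ (Adj H) (φ.strictlyInverseˡ u) (φ.strictlyInverseˡ v) (preserves uv)
  }
  where
  open GraphIso φ
  module φ = Inverse bijection

module _ (φ : GraphIso (C₄ □ C₄) Q₄) where
  private
    Φ = GraphIso.bijection φ
    module Φ = Inverse Φ

  square⇒magicFaced : ∀ {A} → MagicSquare A → MagicFaced (A ↔-∘ ↔-sym Φ)
  square⇒magicFaced square c d =
    trans (square⇒cycles square (mapCycle (symIso φ) c))
      (sym (square⇒cycles square (mapCycle (symIso φ) d)))

  magicFaced⇒square : ∀ L → MagicFaced L → MagicSquare (L ↔-∘ Φ)
  magicFaced⇒square L magic = cycles⇒square λ c →
    magicFaced⇒cycles L magic (Q₄⇒FQ₄-cycle (mapCycle φ c))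

  arrangements-faithful-transitive :
    ActsFaithfullyTransitivelyOn (actionOnArrangements φ) MagicSquare
  arrangements-faithful-transitive = stable , faithful , transitive
    where
    -- The labelling on which `g` acts when the transported action is applied to `L₀ ↔-∘ Φ`; it
    -- equals `L₀` only pointwise.
    L₀∘φ∘φ⁻¹ : V ↔ Fin 16
    L₀∘φ∘φ⁻¹ = (L₀ ↔-∘ Φ) ↔-∘ ↔-sym Φ

    stable : Stable (actionOnArrangements φ) MagicSquare
    stable g {A} square = magicFaced⇒square (g · (A ↔-∘ ↔-sym Φ))
      (magicFaced-stable g {A ↔-∘ ↔-sym Φ} (square⇒magicFaced square))

    faithful : Faithful (restrict (actionOnArrangements φ) MagicSquare stable)
    faithful g fixes = labellings-free g (Group.ε (Aut FQ₄)) L₀∘φ∘φ⁻¹ λ v →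
      trans (cong (Inverse.to (g · L₀∘φ∘φ⁻¹)) (sym (Φ.strictlyInverseˡ v)))
        (fixes (L₀ ↔-∘ Φ , magicFaced⇒square L₀ L₀-magic) (Φ.from v))

    transitive : Transitive (restrict (actionOnArrangements φ) MagicSquare stable)
    transitive (A , A-magic) (B , B-magic) =
      let g , gA≗B = carry (A ↔-∘ ↔-sym Φ) (B ↔-∘ ↔-sym Φ)
            (square⇒magicFaced A-magic) (square⇒magicFaced B-magic)
      in  g , λ p → trans (gA≗B (Φ.to p)) (cong (Inverse.to B) (Φ.strictlyInverseʳ p))

  arrangements↔tesseracts : Inverse MagicArrangement MagicFacedTesseract
  arrangements↔tesseracts = record
    { to        = λ (A , square) → A ↔-∘ ↔-sym Φ , square⇒magicFaced square
    ; from      = λ (L , magic) → L ↔-∘ Φ , magicFaced⇒square L magic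
    ; to-cong   = λ A≈B v → A≈B (Φ.from v)
    ; from-cong = λ L≈M p → L≈M (Φ.to p)
    ; inverse   =
        (λ {(L , _)} A≈ v → trans (A≈ (Φ.from v)) (cong (Inverse.to L) (Φ.strictlyInverseˡ v))) ,
        (λ {(A , _)} L≈ p → trans (L≈ (Φ.to p)) (cong (Inverse.to A) (Φ.strictlyInverseʳ p)))
    }

theorem7 : 2 ^ 4 * 5 ! ≡ 1920
    × HasCardinality MagicFacedTesseract 1920
    × HasCardinality MagicArrangement 1920
    × HasCardinality (Group.setoid (Aut FQ₄)) 1920
    × Aut FQ₄ ≅ᴳ C₂⁴⋊S₅
    × ActsFaithfullyTransitivelyOn actionOnLabellings MagicFaced
    × GraphIso (C₄ □ C₄) Q₄
    × ((φ : GraphIso (C₄ □ C₄) Q₄) →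
    ActsFaithfullyTransitivelyOn (actionOnArrangements φ) MagicSquare)
theorem7 =
    refl
  , ∣MagicFacedTesseract∣≡1920
  , Composition.inverse (arrangements↔tesseracts grayCode) ∣MagicFacedTesseract∣≡1920
  , ∣Aut[FQ₄]∣≡1920
  , Aut[FQ₄]≅C₂⁴⋊S₅
  , labellings-faithful-transitive
  , grayCode
  , arrangements-faithful-transitive
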